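{- Let $s\ge 1$. Suppose that $U_s$ consists of all inequivalent binary self-dual $[2s,s]$ codes, i.e. $U_s$ contains exactly one code from every equivalence class of binary self-dual $[2s,s]$ codes. Then the set $U_{s+1}$ obtained by the algorithm described in the context (with input set $U_s$ and target dimension $s+1$) consists of all inequivalent binary self-dual $[2s+2,s+1]$ codes, i.e. it contains exactly one code from every equivalence class of binary self-dual $[2s+2,s+1]$ codes.
   Context: All codes are binary linear codes; a self-dual code of dimension $k$ has length $2k$. A permutation $\sigma\in S_n$ acts on a code of length $n$ by moving coordinate $i$ to position $\sigma(i)$. Two codes are equivalent ($\cong$) if one is the image of the other under a coordinate permutation; $\mathrm{Aut}(C)=\{\sigma: \sigma(C)=C\}$. Two coordinates $i,j$ of a code $C$ are called equal if $x_i=x_j$ for all $x\in C$. Canonical forms. Let $\Omega_k$ be the set of all binary self-dual codes of dimension $k$. For each $k\ge 2$ a canonical representative map is fixed: a function $\rho:\Omega_k\to\Omega_k$ with $\rho(X)\cong X$ for all $X$, and $\rho(X)=\rho(Y)$ whenever $X\cong Y$; it is assumed to be chosen so that the last two coordinates of every code $\rho(X)$ are not equal. A canonical permutation of $B\in\Omega_k$ is any $\phi\in S_{2k}$ with $\phi(B)=\rho(B)$. Parent test. Given a canonical permutation $\phi_B$ of $B\in\Omega_k$, let $c_1,c_2$ be the coordinates with $\phi_B(c_1)=2k$, $\phi_B(c_2)=2k-1$. The code $B$ passes the parent test if there is $\sigma\in\mathrm{Aut}(B)$ with $\{\sigma(c_1),\sigma(c_2)\}=\{2k-1,2k\}$;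 equivalently, if there is a canonical permutation $\phi$ of $B$ with $\{\phi(2k-1),\phi(2k)\}=\{2k-1,2k\}$. Child type codes. Let $A$ be a self-dual $[2k-2,k-1]$ code with a generator matrix $G_A$ in systematic form (i.e. containing the identity matrix $I_{k-1}$ in the columns of some information set). For $a=(a_1,\dots,a_{k-1})\in\mathbb{F}_2^{k-1}$ of odd weight, let $C_0$ be the code of length $2k$ generated by $(G_A\mid a^T\ a^T)$, and let $x\in\mathbb{F}_2^{2k}$ be the vector with $x_{2k-1}=1$, $x_{2k}=0$, whose entries in the information positions of $G_A$ are $a_1,\dots,a_{k-1}$ and whose other entries are $0$. The code $\langle C_0,x\rangle$ is a self-dual $[2k,k]$ code, the child type code of $A$ defined by $a$. Each automorphism $P$ of $A$ (as a permutation matrix) determines the invertible matrix $A_P\in\mathrm{GL}(k-1,2)$ with $G_AP=A_PG_A$, and $\mathrm{Aut}(A)$ acts on the odd-weight vectors of $\mathbb{F}_2^{k-1}$ via $a^T\mapsto A_Pa^T$. $Child(A)$ denotes the set of child type codes of $A$ obtained by taking one representative vector $a$ from each orbit of this action. Algorithm. Input: a nonempty set $U_r$ of binary self-dual $[2r,r]$ codes and an integer $k>r$. Output: a set $U_k$ of self-dual $[2k,k]$ codes. Start with $U_k=\emptyset$ and call Augmentation$(A)$ for every $A\in U_r$, where Augmentation$(A)$ is the recursive procedure: if $\dim A=k$, add $A$ to $U_k$; if $\dim A<k$, compute $Child(A)$, and for every $B\in Child(A)$ that passes the parent test, call Augmentation$(B)$. -}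

module Defs where

open import Data.Fin.Base using (Fin; fromℕ; inject₁)
open import Data.Fin.Permutation using (Permutation′; _⟨$⟩ʳ_; _⟨$⟩ˡ_)
open import Data.Fin.Properties using (_≟_; any?)
open import Data.Nat.Base using (ℕ; suc; _*_; _<_; NonZero; parity)
open import Data.Parity.Base as ℙ using (Parity; 0ℙ; 1ℙ)
open import Data.Parity.Properties as ℙₚ using ()
open import Data.Product.Base using (∃; ∃-syntax; _×_; _,_; proj₁)
open import Data.Sum.Base using (_⊎_)
open import Data.Vec.Base
  using (Vec; []; _∷_; _∷ʳ_; count; foldr′; lookup; map; replicate; tabulate; zipWith)
open import Level using (0ℓ; _⊔_) renaming (suc to ℓsuc)
open import Relation.Binary.PropositionalEquality.Core using (_≡_)
open import Relation.Nullary using (¬_; yes; no)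
open import Relation.Unary using (Pred; _∈_; _≐_)

private
  variable
    k m n : ℕ

F₂ : Set
F₂ = Parity

Word : ℕ → Set
Word n = Vec F₂ n

Matrix : ℕ → ℕ → Set
Matrix m n = Vec (Word n) m

infixl 6 _⊕_
infixr 7 _·_
infix  7 _∙_ _⊛_ _⊗_ _⊡_

𝟎 : Word n
𝟎 = replicate _ 0ℙ

_⊕_ : Word n → Word n → Word n
_⊕_ = zipWith ℙ._+_

_·_ : F₂ → Word n → Word n
c · x = map (c ℙ.*_) x

_∙_ : Word n → Word n → F₂
x ∙ y = foldr′ ℙ._+_ 0ℙ (zipWith ℙ._*_ x y)

-- Row vector times matrix: the combination of the rows of G with coefficients c.
_⊛_ : Word m → Matrix m n → Word n
[]      ⊛ []      = 𝟎
(c ∷ v) ⊛ (g ∷ G) = c · g ⊕ v ⊛ G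

_⊗_ : Matrix k m → Matrix m n → Matrix k n
M ⊗ G = map (_⊛ G) M

_⊡_ : Matrix m n → Word n → Word m
M ⊡ a = map (_∙ a) M

Span : Matrix m n → Pred (Word n) 0ℓ
Span G x = ∃[ c ] x ≡ c ⊛ G

LinearlyIndependent : Matrix m n → Set
LinearlyIndependent G = ∀ c → c ⊛ G ≡ 𝟎 → c ≡ 𝟎

weight : Word n → ℕ
weight = count (ℙₚ._≟ 1ℙ)

OddWeight : Pred (Word n) 0ℓ
OddWeight a = parity (weight a) ≡ 1ℙ

-- Closure under scalars is automatic over F₂.
record LinearCode (n : ℕ) : Set₁ where
  field
    words    : Pred (Word n) 0ℓ
    𝟎∈       : 𝟎 ∈ words
    ⊕-closed : ∀ {x y} → x ∈ words → y ∈ words → x ⊕ y ∈ words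

IsGeneratorMatrix : Matrix k n → Pred (Word n) 0ℓ → Set
IsGeneratorMatrix G C = Span G ≐ C × LinearlyIndependent G

HasDimension : Pred (Word n) 0ℓ → ℕ → Set
HasDimension {n} C k = ∃ λ (G : Matrix k n) → IsGeneratorMatrix G C

Dual : Pred (Word n) 0ℓ → Pred (Word n) 0ℓ
Dual C x = ∀ {y} → y ∈ C → x ∙ y ≡ 0ℙ

-- The self-dual [2k,k] codes.  The length is written k * 2 so that passing from
-- k to suc k adds two coordinates definitionally.  Two codes are the same code
-- when their sets of words coincide: words A ≐ words B.
record Ω (k : ℕ) : Set₁ where
  field
    code : LinearCode (k * 2)
  open LinearCode code public
  field
    dimension : HasDimension words k
    selfDual  : words ≐ Dual words

open Ω public using (words)

-- Coordinate i moves to position σ i.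
act : Permutation′ n → Word n → Word n
act σ x = tabulate λ j → lookup x (σ ⟨$⟩ˡ j)

Image : Permutation′ n → Pred (Word n) 0ℓ → Pred (Word n) 0ℓ
Image σ C y = ∃[ x ] x ∈ C × y ≡ act σ x

infix 4 _≅_

_≅_ : Ω k → Ω k → Set
A ≅ B = ∃[ σ ] Image σ (words A) ≐ words B

Aut : Pred (Word n) 0ℓ → Pred (Permutation′ n) 0ℓ
Aut C σ = Image σ C ≐ C

EqualCoordinates : Pred (Word n) 0ℓ → Fin n → Fin n → Set
EqualCoordinates C i j = ∀ {x} → x ∈ C → lookup x i ≡ lookup x j

ultimate penultimate : Fin (suc (suc n))
ultimate    {n} = fromℕ (suc n)
penultimate {n} = inject₁ (fromℕ n)

-- The dimensions k ≥ 2 are those of the form suc m with m nonzero.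
record CanonicalRepresentatives : Set₁ where
  field
    ρ           : .{{_ : NonZero m}} → Ω (suc m) → Ω (suc m)
    ρ-≅         : .{{_ : NonZero m}} (X : Ω (suc m)) → ρ X ≅ X
    ρ-invariant : .{{_ : NonZero m}} {X Y : Ω (suc m)} → X ≅ Y →
                  words (ρ X) ≐ words (ρ Y)
    ρ-lastTwo   : .{{_ : NonZero m}} (X : Ω (suc m)) →
                  ¬ EqualCoordinates (words (ρ X)) penultimate ultimate

  IsCanonicalPermutation : .{{_ : NonZero m}} → Ω (suc m) →
                           Permutation′ (suc m * 2) → Set
  IsCanonicalPermutation B φ = Image φ (words B) ≐ words (ρ B)

CanonicalPermutations : CanonicalRepresentatives → Set₁
CanonicalPermutations reps =
  ∀ {m} .{{_ : NonZero m}} (B : Ω (suc m)) → ∃ (IsCanonicalPermutation B)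
  where open CanonicalRepresentatives reps

PassesParentTest : (B : Ω (suc m)) → Permutation′ (suc m * 2) → Set
PassesParentTest B φ = ∃[ σ ] σ ∈ Aut (words B) ×
  ( (σ ⟨$⟩ʳ c₁ ≡ ultimate    × σ ⟨$⟩ʳ c₂ ≡ penultimate)
  ⊎ (σ ⟨$⟩ʳ c₁ ≡ penultimate × σ ⟨$⟩ʳ c₂ ≡ ultimate) )
  where
  c₁ = φ ⟨$⟩ˡ ultimate
  c₂ = φ ⟨$⟩ˡ penultimate

unit : Fin n → Word n
unit i = tabulate λ j → δ i j
  where
  δ : Fin n → Fin n → F₂
  δ i j with i ≟ j
  ... | yes _ = 1ℙ
  ... | no  _ = 0ℙ

-- Column lookup information j of the matrix is the j-th column of the identity.
record SystematicGenerator (A : Ω m) : Set where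
  field
    matrix      : Matrix m (m * 2)
    generates   : IsGeneratorMatrix matrix (words A)
    information : Vec (Fin (m * 2)) m
    identity    : ∀ j → map (λ g → lookup g (lookup information j)) matrix ≡ unit j

-- The word with the entries of a in the information positions and 0 elsewhere.
spread : Vec (Fin n) m → Word m → Word n
spread {n} {m} J a = tabulate entry
  where
  entry : Fin n → F₂
  entry p with any? (λ (j : Fin m) → lookup J j ≟ p)
  ... | yes (j , _) = lookup a j
  ... | no  _       = 0ℙ

-- The rows of (G | aᵀ aᵀ).
extend : Matrix m n → Word m → Matrix m (suc (suc n))
extend G a = zipWith (λ g c → g ∷ʳ c ∷ʳ c) G a

childWords : {A : Ω m} → SystematicGenerator A → Word m → Pred (Word (suc m * 2)) 0ℓ
childWords S a = Span (x ∷ extend matrix a)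
  where
  open SystematicGenerator S
  x = spread information a ∷ʳ 1ℙ ∷ʳ 0ℙ

-- a and b lie in one orbit of Aut(A): b = M a, where M is the matrix of some
-- P ∈ Aut(A).  Permuting the columns of G gives G P, so M is the solution of
-- G P = M G; it is unique since the rows of G are independent, and invertible
-- since P is.
SameOrbit : {A : Ω m} → SystematicGenerator A → Word m → Word m → Set
SameOrbit {m} {A} S a b =
  ∃[ P ] P ∈ Aut (words A) × (∃ λ (M : Matrix m m) →
    map (act P) matrix ≡ M ⊗ matrix × b ≡ M ⊡ a)
  where open SystematicGenerator S

record IsOrbitTransversal {A : Ω m} (S : SystematicGenerator A)
                          (T : Pred (Word m) 0ℓ) : Set where
  field
    odd    : ∀ {a} → a ∈ T → OddWeight a
    meets  : ∀ {a} → OddWeight a → ∃[ t ] t ∈ T × SameOrbit S a t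
    unique : ∀ {t u} → t ∈ T → u ∈ T → SameOrbit S t u → t ≡ u

-- The choices behind Child(A): a systematic generator matrix of A and a set of
-- orbit representatives.  The -cong fields say that they depend on the set of
-- words of A only, not on how A is presented as an element of Ω m.
record ChildChoices : Set₁ where
  field
    systematic      : (A : Ω m) → SystematicGenerator A
    transversal     : (A : Ω m) → Pred (Word m) 0ℓ
    isTransversal   : (A : Ω m) → IsOrbitTransversal (systematic A) (transversal A)

  open module Systematic {m} (A : Ω m) = SystematicGenerator (systematic A) public

  field
    matrix-cong      : {A B : Ω m} → words A ≐ words B → matrix A ≡ matrix B
    information-cong : {A B : Ω m} → words A ≐ words B → information A ≡ information B
    transversal-cong : {A B : Ω m} → words A ≐ words B → transversal A ≐ transversal B

  Child : Ω m → Pred (Ω (suc m)) 0ℓ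
  Child A B = ∃[ a ] a ∈ transversal A × words B ≐ childWords (systematic A) a

module Algorithm (reps : CanonicalRepresentatives)
                 (φ : CanonicalPermutations reps)
                 (choices : ChildChoices) where

  open ChildChoices choices using (Child)

  -- C ∈ Augmentation A: the call Augmentation(A) with target dimension k adds C.
  data Augmentation {k : ℕ} : {n : ℕ} → .{{NonZero n}} → Ω n → Pred (Ω k) (ℓsuc 0ℓ) where
    add     : .{{_ : NonZero k}} {A : Ω k} → A ∈ Augmentation A
    augment : .{{_ : NonZero n}} {A : Ω n} {B : Ω (suc n)} {C : Ω k} →
              n < k → B ∈ Child A → PassesParentTest B (proj₁ (φ B)) →
              C ∈ Augmentation B → C ∈ Augmentation A

  -- The set U_k computed from the input set U = U_r.
  Output : ∀ {r ℓ} .{{_ : NonZero r}} → Pred (Ω r) ℓ → (k : ℕ) → Pred (Ω k) (ℓsuc 0ℓ ⊔ ℓ)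
  Output U k C = ∃[ A ] A ∈ U × C ∈ Augmentation A

record ConsistsOfAllInequivalent {ℓ} (U : Pred (Ω k) ℓ) : Set (ℓsuc 0ℓ ⊔ ℓ) where
  field
    atLeastOne : ∀ B → ∃[ A ] A ∈ U × A ≅ B
    atMostOne  : ∀ {A B} → A ∈ U → B ∈ U → A ≅ B → words A ≐ words B

{-# OPTIONS --safe #-}

-- A child type code B of A is determined by A and a, and its words with equal last two coordinates
-- form the span of (G | aᵀ aᵀ); deleting those two coordinates gives back A.  B passes the parent test
-- exactly when ρ(B) is mapped onto B by a permutation preserving the set of the last two coordinates.
--
-- At least one: the last two coordinates of ρ(B) are not equal, so its words that agree there, with
-- these coordinates deleted, form a self-dual code A₀ of dimension s.  Replacing A₀ by the equivalent
-- code A ∈ U and moving to an orbit representative changes ρ(B) only by permutations preserving the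
-- last two coordinates, so the resulting child of A passes the parent test and is equivalent to B.
--
-- At most one: two equivalent codes that pass have the same canonical form, hence are related by a
-- permutation preserving the last two coordinates.  It restricts to an equivalence of the parents,
-- which are therefore the same code A, and to an automorphism of A relating the two orbit
-- representatives, which are therefore equal.
module Submission where

open import Defs
import Algebra.Properties.CommutativeMonoid.Sum as CommutativeMonoidSum
import Algebra.Properties.CommutativeSemigroup as CommutativeSemigroupProperties
open import Data.Empty using (⊥-elim)
open import Data.Fin.Base using (Fin; zero; suc; fromℕ; inject₁)
open import Data.Fin.Permutation
  using (Permutation′; id; _⟨$⟩ʳ_; _⟨$⟩ˡ_; flip; _∘ₚ_; permutation; transpose; inverseˡ; inverseʳ)
open import Data.Fin.Properties using (_≟_; any?; inject₁-injective; fromℕ≢inject₁)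
open import Data.Fin.Relation.Unary.Top using (view; ‵fromℕ; ‵inject₁; view-fromℕ; view-inject₁)
open import Data.Nat.Base as ℕ using (ℕ; zero; suc; NonZero; parity)
open import Data.Nat.Properties using (n<1+n; <-irrefl)
open import Data.Parity.Base
  using (0ℙ; 1ℙ; _⁻¹)
  renaming (_+_ to infixl 6 _+_; _*_ to infixl 6.5 _*_)
open import Data.Parity.Properties as ℙₚ using ()
open import Data.Product.Base using (∃; ∃₂; ∃-syntax; _×_; _,_; proj₁; proj₂)
open import Data.Sum.Base using (_⊎_; inj₁; inj₂)
open import Data.Vec.Base
  using (Vec; []; _∷_; _∷ʳ_; init; initLast; lookup; map; replicate; tabulate)
open import Data.Vec.Properties
  using (lookup∘tabulate; tabulate∘lookup; tabulate-cong; lookup-zipWith; lookup-replicate;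
         lookup-map; zipWith-assoc; zipWith-comm; zipWith-identityˡ; zipWith-identityʳ;
         ∷ʳ-injective; ∷-injective; map-∷ʳ; init-∷ʳ; map-id)
open import Function.Base using (_∘_; case_of_)
open import Level using (Level; 0ℓ)
open import Relation.Binary.PropositionalEquality
  using (_≡_; _≢_; refl; sym; trans; cong; cong₂; subst; subst₂; module ≡-Reasoning)
open import Relation.Nullary using (¬_; yes; no; contradiction)
open import Relation.Unary using (Pred; _∈_; _⊆_; _≐_)
open import Relation.Unary.Properties using (≐-sym; ≐-trans)

open CommutativeMonoidSum ℙₚ.+-0-commutativeMonoid using (sum; sum-cong-≗; sum-permute)
open CommutativeSemigroupProperties ℙₚ.+-commutativeSemigroup
  using () renaming (interchange to +-interchange)

private
  variable
    k m n : ℕ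

-- Linear algebra over F₂

⊕-identityˡ : (x : Word n) → 𝟎 ⊕ x ≡ x
⊕-identityˡ = zipWith-identityˡ ℙₚ.+-identityˡ

⊕-identityʳ : (x : Word n) → x ⊕ 𝟎 ≡ x
⊕-identityʳ = zipWith-identityʳ ℙₚ.+-identityʳ

⊕-assoc : (x y z : Word n) → (x ⊕ y) ⊕ z ≡ x ⊕ (y ⊕ z)
⊕-assoc = zipWith-assoc ℙₚ.+-assoc

⊕-comm : (x y : Word n) → x ⊕ y ≡ y ⊕ x
⊕-comm = zipWith-comm ℙₚ.+-comm

⊕-self : (x : Word n) → x ⊕ x ≡ 𝟎
⊕-self []      = refl
⊕-self (p ∷ x) = cong₂ _∷_ (ℙₚ.p+p≡0ℙ p) (⊕-self x)

⊕-cancelˡ : (x y : Word n) → x ⊕ (x ⊕ y) ≡ y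
⊕-cancelˡ x y = trans (sym (⊕-assoc x x y)) (trans (cong (_⊕ y) (⊕-self x)) (⊕-identityˡ y))

⊕-interchange : (x y z w : Word n) → (x ⊕ y) ⊕ (z ⊕ w) ≡ (x ⊕ z) ⊕ (y ⊕ w)
⊕-interchange []      []      []      []      = refl
⊕-interchange (p ∷ x) (q ∷ y) (r ∷ z) (s ∷ w) =
  cong₂ _∷_ (+-interchange p q r s) (⊕-interchange x y z w)

·-zeroˡ : (x : Word n) → 0ℙ · x ≡ 𝟎
·-zeroˡ []      = refl
·-zeroˡ (p ∷ x) = cong (0ℙ ∷_) (·-zeroˡ x)

·-identityˡ : (x : Word n) → 1ℙ · x ≡ x
·-identityˡ = map-id

·-distribʳ : (p q : F₂) (x : Word n) → (p + q) · x ≡ p · x ⊕ q · x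
·-distribʳ p q []      = refl
·-distribʳ p q (r ∷ x) = cong₂ _∷_ (ℙₚ.*-distribʳ-+ r p q) (·-distribʳ p q x)

·-distribˡ : (p : F₂) (x y : Word n) → p · (x ⊕ y) ≡ p · x ⊕ p · y
·-distribˡ p []      []      = refl
·-distribˡ p (q ∷ x) (r ∷ y) = cong₂ _∷_ (ℙₚ.*-distribˡ-+ p q r) (·-distribˡ p x y)

·-assoc : (p q : F₂) (x : Word n) → p · q · x ≡ (p * q) · x
·-assoc p q []      = refl
·-assoc p q (r ∷ x) = cong₂ _∷_ (sym (ℙₚ.*-assoc p q r)) (·-assoc p q x)

∙-comm : (x y : Word n) → x ∙ y ≡ y ∙ x
∙-comm []      []      = refl
∙-comm (p ∷ x) (q ∷ y) = cong₂ _+_ (ℙₚ.*-comm p q) (∙-comm x y)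

∙-zeroˡ : (x : Word n) → 𝟎 ∙ x ≡ 0ℙ
∙-zeroˡ []      = refl
∙-zeroˡ (p ∷ x) = ∙-zeroˡ x

∙-zeroʳ : (x : Word n) → x ∙ 𝟎 ≡ 0ℙ
∙-zeroʳ x = trans (∙-comm x 𝟎) (∙-zeroˡ x)

∙-distribʳ : (x y z : Word n) → (x ⊕ y) ∙ z ≡ x ∙ z + y ∙ z
∙-distribʳ []      []      []      = refl
∙-distribʳ (p ∷ x) (q ∷ y) (r ∷ z) = trans
  (cong₂ _+_ (ℙₚ.*-distribʳ-+ r p q) (∙-distribʳ x y z))
  (+-interchange (p * r) (q * r) (x ∙ z) (y ∙ z))

∙-distribˡ : (x y z : Word n) → x ∙ (y ⊕ z) ≡ x ∙ y + x ∙ z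
∙-distribˡ x y z = trans (∙-comm x (y ⊕ z))
  (trans (∙-distribʳ y z x) (cong₂ _+_ (∙-comm y x) (∙-comm z x)))

·-∙ : (p : F₂) (x y : Word n) → (p · x) ∙ y ≡ p * x ∙ y
·-∙ p []      []      = sym (ℙₚ.*-zeroʳ p)
·-∙ p (q ∷ x) (r ∷ y) = trans
  (cong₂ _+_ (ℙₚ.*-assoc p q r) (·-∙ p x y))
  (sym (ℙₚ.*-distribˡ-+ p (q * r) (x ∙ y)))

∙-self : (x : Word n) → x ∙ x ≡ x ∙ replicate n 1ℙ
∙-self []      = refl
∙-self (p ∷ x) = cong₂ _+_ (trans (ℙₚ.*-idem p) (sym (ℙₚ.*-identityʳ p))) (∙-self x)

parity-weight : (x : Word n) → parity (weight x) ≡ x ∙ replicate n 1ℙ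
parity-weight []       = refl
parity-weight (0ℙ ∷ x) = parity-weight x
parity-weight (1ℙ ∷ x) = begin
  parity (suc (weight x))        ≡⟨ ℙₚ.⁻¹-involutive _ ⟨
  parity (suc (weight x)) ⁻¹ ⁻¹  ≡⟨ cong _⁻¹ (ℙₚ.suc-homo-⁻¹ (weight x)) ⟩
  parity (weight x) ⁻¹           ≡⟨ cong _⁻¹ (parity-weight x) ⟩
  (x ∙ replicate _ 1ℙ) ⁻¹        ∎
  where open ≡-Reasoning

⊛-∙ : (v : Word m) (G : Matrix m n) (y : Word n) → (v ⊛ G) ∙ y ≡ v ∙ (G ⊡ y)
⊛-∙ []      []      y = ∙-zeroˡ y
⊛-∙ (p ∷ v) (g ∷ G) y = trans (∙-distribʳ (p · g) (v ⊛ G) y)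
  (cong₂ _+_ (·-∙ p g y) (⊛-∙ v G y))

⊛-zeroˡ : (G : Matrix m n) → 𝟎 ⊛ G ≡ 𝟎
⊛-zeroˡ []      = refl
⊛-zeroˡ (g ∷ G) = trans (cong₂ _⊕_ (·-zeroˡ g) (⊛-zeroˡ G)) (⊕-identityˡ 𝟎)

⊛-distribʳ : (v w : Word m) (G : Matrix m n) → (v ⊕ w) ⊛ G ≡ v ⊛ G ⊕ w ⊛ G
⊛-distribʳ []      []      []      = sym (⊕-identityˡ 𝟎)
⊛-distribʳ (p ∷ v) (q ∷ w) (g ∷ G) = trans
  (cong₂ _⊕_ (·-distribʳ p q g) (⊛-distribʳ v w G))
  (⊕-interchange (p · g) (q · g) (v ⊛ G) (w ⊛ G))

·-⊛ : (p : F₂) (v : Word m) (G : Matrix m n) → (p · v) ⊛ G ≡ p · (v ⊛ G)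
·-⊛ 0ℙ v G = trans (cong (_⊛ G) (·-zeroˡ v)) (trans (⊛-zeroˡ G) (sym (·-zeroˡ (v ⊛ G))))
·-⊛ 1ℙ v G = trans (cong (_⊛ G) (·-identityˡ v)) (sym (·-identityˡ (v ⊛ G)))

⊛-⊗ : (v : Word k) (M : Matrix k m) (G : Matrix m n) → v ⊛ (M ⊗ G) ≡ (v ⊛ M) ⊛ G
⊛-⊗ []      []      G = sym (⊛-zeroˡ G)
⊛-⊗ (p ∷ v) (r ∷ M) G = sym (trans (⊛-distribʳ (p · r) (v ⊛ M) G)
  (cong₂ _⊕_ (·-⊛ p r G) (sym (⊛-⊗ v M G))))

head-⊛ : (g : Word n) (G : Matrix m n) → (1ℙ ∷ 𝟎) ⊛ (g ∷ G) ≡ g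
head-⊛ g G = trans (cong₂ _⊕_ (·-identityˡ g) (⊛-zeroˡ G)) (⊕-identityʳ g)

tail-⊛ : (v : Word m) (g : Word n) (G : Matrix m n) → (0ℙ ∷ v) ⊛ (g ∷ G) ≡ v ⊛ G
tail-⊛ v g G = trans (cong (_⊕ v ⊛ G) (·-zeroˡ g)) (⊕-identityˡ (v ⊛ G))

IsLinear : (Word m → Word n) → Set
IsLinear f = f 𝟎 ≡ 𝟎 × (∀ x y → f (x ⊕ y) ≡ f x ⊕ f y)

map-⊛ : (f : Word k → Word n) → IsLinear f →
        (v : Word m) (G : Matrix m k) → f (v ⊛ G) ≡ v ⊛ map f G
map-⊛ f (f-𝟎 , f-⊕) []       []      = f-𝟎
map-⊛ f (f-𝟎 , f-⊕) (0ℙ ∷ v) (g ∷ G) = begin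
  f ((0ℙ ∷ v) ⊛ (g ∷ G))       ≡⟨ cong f (tail-⊛ v g G) ⟩
  f (v ⊛ G)                    ≡⟨ map-⊛ f (f-𝟎 , f-⊕) v G ⟩
  v ⊛ map f G                  ≡⟨ tail-⊛ v (f g) (map f G) ⟨
  (0ℙ ∷ v) ⊛ map f (g ∷ G)     ∎
  where open ≡-Reasoning
map-⊛ f (f-𝟎 , f-⊕) (1ℙ ∷ v) (g ∷ G) = begin
  f (1ℙ · g ⊕ v ⊛ G)           ≡⟨ f-⊕ (1ℙ · g) (v ⊛ G) ⟩
  f (1ℙ · g) ⊕ f (v ⊛ G)       ≡⟨ cong₂ _⊕_ (cong f (·-identityˡ g)) (map-⊛ f (f-𝟎 , f-⊕) v G) ⟩
  f g ⊕ v ⊛ map f G            ≡⟨ cong (_⊕ v ⊛ map f G) (·-identityˡ (f g)) ⟨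
  1ℙ · f g ⊕ v ⊛ map f G       ∎
  where open ≡-Reasoning

Span-tail : {g : Word n} {G : Matrix m n} → Span G ⊆ Span (g ∷ G)
Span-tail {g = g} {G} (v , refl) = (0ℙ ∷ v) , sym (tail-⊛ v g G)

LinearlyIndependent-tail : {g : Word n} {G : Matrix m n} →
                           LinearlyIndependent (g ∷ G) → LinearlyIndependent G
LinearlyIndependent-tail {g = g} {G} ind v v⊛G≡𝟎 =
  proj₂ (∷-injective (ind (0ℙ ∷ v) (trans (tail-⊛ v g G) v⊛G≡𝟎)))

-- Elimination against one linear functional

shear : Word n → Word n → Matrix m n → Matrix m n
shear u g = map λ h → h ⊕ (h ∙ u) · g

⊛-shear : (u g : Word n) (v : Word m) (G : Matrix m n) →
          v ⊛ shear u g G ≡ v ⊛ G ⊕ (v ∙ (G ⊡ u)) · g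
⊛-shear u g []      []      = sym (trans (⊕-identityˡ (0ℙ · g)) (·-zeroˡ g))
⊛-shear u g (p ∷ v) (h ∷ G) = begin
  p · (h ⊕ (h ∙ u) · g) ⊕ v ⊛ shear u g G
    ≡⟨ cong₂ _⊕_ (trans (·-distribˡ p h ((h ∙ u) · g)) (cong (p · h ⊕_) (·-assoc p (h ∙ u) g)))
                 (⊛-shear u g v G) ⟩
  (p · h ⊕ (p * h ∙ u) · g) ⊕ (v ⊛ G ⊕ (v ∙ (G ⊡ u)) · g)
    ≡⟨ ⊕-interchange (p · h) _ (v ⊛ G) _ ⟩
  (p · h ⊕ v ⊛ G) ⊕ ((p * h ∙ u) · g ⊕ (v ∙ (G ⊡ u)) · g)
    ≡⟨ cong ((p · h ⊕ v ⊛ G) ⊕_) (sym (·-distribʳ (p * h ∙ u) (v ∙ (G ⊡ u)) g)) ⟩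
  (p · h ⊕ v ⊛ G) ⊕ ((p * h ∙ u) + v ∙ (G ⊡ u)) · g ∎
  where open ≡-Reasoning

shear-⊡ : (u g : Word n) (G : Matrix m n) → g ∙ u ≡ 1ℙ → shear u g G ⊡ u ≡ 𝟎
shear-⊡ u g []      g∙u≡1 = refl
shear-⊡ u g (h ∷ G) g∙u≡1 = cong₂ _∷_ eq (shear-⊡ u g G g∙u≡1)
  where
  open ≡-Reasoning
  eq : (h ⊕ (h ∙ u) · g) ∙ u ≡ 0ℙ
  eq = begin
    (h ⊕ (h ∙ u) · g) ∙ u            ≡⟨ ∙-distribʳ h ((h ∙ u) · g) u ⟩
    h ∙ u + ((h ∙ u) · g) ∙ u      ≡⟨ cong (h ∙ u +_) (·-∙ (h ∙ u) g u) ⟩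
    h ∙ u + h ∙ u * g ∙ u        ≡⟨ cong (λ r → h ∙ u + h ∙ u * r) g∙u≡1 ⟩
    h ∙ u + h ∙ u * 1ℙ           ≡⟨ cong (h ∙ u +_) (ℙₚ.*-identityʳ (h ∙ u)) ⟩
    h ∙ u + h ∙ u                  ≡⟨ ℙₚ.p+p≡0ℙ (h ∙ u) ⟩
    0ℙ                               ∎

-- Shearing changes only the coefficient of `g`. The change `p ↦ p + v ∙ (G ⊡ u)` is an involution
-- over F₂, so this one identity yields both inclusions of the spans and the independence in
-- `pivotHead`.
∷-⊛-shear : (u g : Word n) (p : F₂) (v : Word m) (G : Matrix m n) →
            (p ∷ v) ⊛ (g ∷ shear u g G) ≡ (p + v ∙ (G ⊡ u) ∷ v) ⊛ (g ∷ G)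
∷-⊛-shear u g p v G = begin
  p · g ⊕ v ⊛ shear u g G                   ≡⟨ cong (p · g ⊕_) (trans (⊛-shear u g v G) (⊕-comm (v ⊛ G) _)) ⟩
  p · g ⊕ ((v ∙ (G ⊡ u)) · g ⊕ v ⊛ G)       ≡⟨ ⊕-assoc (p · g) _ (v ⊛ G) ⟨
  (p · g ⊕ (v ∙ (G ⊡ u)) · g) ⊕ v ⊛ G       ≡⟨ cong (_⊕ v ⊛ G) (sym (·-distribʳ p (v ∙ (G ⊡ u)) g)) ⟩
  (p + v ∙ (G ⊡ u)) · g ⊕ v ⊛ G           ∎
  where open ≡-Reasoning

+-cancelʳ : ∀ p q → p + q + q ≡ p
+-cancelʳ p q = trans (ℙₚ.+-assoc p q q) (trans (cong (p +_) (ℙₚ.p+p≡0ℙ q)) (ℙₚ.+-identityʳ p))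

-- A basis of the row space adapted to the functional `_∙ u`: `rest` is a basis of its kernel there.
-- With `u` equal to `lastTwoOnes` it produces a basis of the shortened code.
record Pivoted (u : Word n) (G : Matrix (suc m) n) : Set where
  field
    pivot       : Word n
    rest        : Matrix m n
    pivot∙u≡1   : pivot ∙ u ≡ 1ℙ
    rest⊡u≡𝟎    : rest ⊡ u ≡ 𝟎
    spans       : Span (pivot ∷ rest) ≐ Span G
    independent : LinearlyIndependent (pivot ∷ rest)

pivotHead : (u g : Word n) (G : Matrix m n) → g ∙ u ≡ 1ℙ →
            LinearlyIndependent (g ∷ G) → Pivoted u (g ∷ G)
pivotHead u g G g∙u≡1 ind = record
  { pivot       = g
  ; rest        = shear u g G
  ; pivot∙u≡1   = g∙u≡1
  ; rest⊡u≡𝟎    = shear-⊡ u g G g∙u≡1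
  ; spans       = (λ where (p ∷ v , refl) → (p + v ∙ (G ⊡ u) ∷ v) , ∷-⊛-shear u g p v G)
                , (λ where (p ∷ v , refl) → (p + v ∙ (G ⊡ u) ∷ v) , sym (trans
                             (∷-⊛-shear u g (p + v ∙ (G ⊡ u)) v G)
                             (cong (λ q → (q ∷ v) ⊛ (g ∷ G)) (+-cancelʳ p (v ∙ (G ⊡ u))))))
  ; independent = independent
  }
  where
  independent : LinearlyIndependent (g ∷ shear u g G)
  independent (p ∷ v) eq with ∷-injective (ind (p + v ∙ (G ⊡ u) ∷ v) (trans (sym (∷-⊛-shear u g p v G)) eq))
  ... | p+≡0 , refl = cong (_∷ 𝟎) (begin
    p                       ≡⟨ ℙₚ.+-identityʳ p ⟨
    p + 0ℙ                ≡⟨ cong (p +_) (∙-zeroˡ (G ⊡ u)) ⟨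
    p + 𝟎 ∙ (G ⊡ u)       ≡⟨ p+≡0 ⟩
    0ℙ                      ∎)
    where open ≡-Reasoning

pivotTail : {u g : Word n} {G : Matrix (suc m) n} → g ∙ u ≡ 0ℙ →
            LinearlyIndependent (g ∷ G) → Pivoted u G → Pivoted u (g ∷ G)
pivotTail {u = u} {g} {G} g∙u≡0 ind P = record
  { pivot       = pivot
  ; rest        = g ∷ rest
  ; pivot∙u≡1   = pivot∙u≡1
  ; rest⊡u≡𝟎    = cong₂ _∷_ g∙u≡0 rest⊡u≡𝟎
  ; spans       = (λ where (p ∷ q ∷ v , refl) → case proj₁ spans (p ∷ v , refl) of λ where
                             (w , eq) → (q ∷ w) , trans (swap p q v) (cong (q · g ⊕_) eq))
                , (λ where (q ∷ w , refl) → case proj₂ spans (w , refl) of λ where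
                             (p ∷ v , eq) → (p ∷ q ∷ v) ,
                               trans (cong (q · g ⊕_) eq) (sym (swap p q v)))
  ; independent = independent′
  }
  where
  open Pivoted P
  swap : ∀ p q v → (p ∷ q ∷ v) ⊛ (pivot ∷ g ∷ rest) ≡ q · g ⊕ (p ∷ v) ⊛ (pivot ∷ rest)
  swap p q v = trans (sym (⊕-assoc (p · pivot) (q · g) (v ⊛ rest)))
    (trans (cong (_⊕ v ⊛ rest) (⊕-comm (p · pivot) (q · g))) (⊕-assoc (q · g) (p · pivot) (v ⊛ rest)))
  independent′ : LinearlyIndependent (pivot ∷ g ∷ rest)
  -- The part of the relation in `pivot` and `rest` is rewritten in the rows of `G` with
  -- coefficients `w`. Independence of `g ∷ G` kills `q` and `w`; independence of `pivot ∷ rest`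
  -- then kills `p` and `v`.
  independent′ (p ∷ q ∷ v) eq with proj₁ spans (p ∷ v , refl)
  ... | w , eq′ with ind (q ∷ w) (trans (cong (q · g ⊕_) (sym eq′)) (trans (sym (swap p q v)) eq))
  ... | refl with independent (p ∷ v) (trans eq′ (⊛-zeroˡ G))
  ... | refl = refl

pivoting : (u : Word n) (G : Matrix (suc m) n) → LinearlyIndependent G →
           G ⊡ u ≡ 𝟎 ⊎ Pivoted u G
pivoting u (g ∷ G) ind with g ∙ u in eq
... | 1ℙ = inj₂ (pivotHead u g G eq ind)
-- `Pivoted` is defined for nonempty matrices only, so the recursion has to stop at a single row.
pivoting u (g ∷ [])       ind | 0ℙ = inj₁ refl
pivoting u (g ∷ G@(_ ∷ _)) ind | 0ℙ with pivoting u G (LinearlyIndependent-tail {g = g} ind)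
... | inj₁ G⊡u≡𝟎 = inj₁ (cong (0ℙ ∷_) G⊡u≡𝟎)
... | inj₂ P      = inj₂ (pivotTail eq ind P)

-- The words spread J a

lookup-ext : {x y : Word n} → (∀ i → lookup x i ≡ lookup y i) → x ≡ y
lookup-ext {x = x} {y} eq =
  trans (sym (tabulate∘lookup x)) (trans (tabulate-cong eq) (tabulate∘lookup y))

-- Applied with `refl` to `unit` and `spread`: unification finds their local entry function, which
-- has no name outside, and a simultaneous `with` on its decision then reduces it.
lookup-≡-tabulate : {x : Word n} {f : Fin n → F₂} → x ≡ tabulate f → ∀ i → lookup x i ≡ f i
lookup-≡-tabulate {f = f} refl i = lookup∘tabulate f i

lookup-⊛ : (v : Word m) (G : Matrix m n) (i : Fin n) →
           lookup (v ⊛ G) i ≡ v ∙ map (λ g → lookup g i) G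
lookup-⊛ []      []      i = lookup-replicate i 0ℙ
lookup-⊛ (p ∷ v) (g ∷ G) i = trans (lookup-zipWith _+_ i (p · g) (v ⊛ G))
  (cong₂ _+_ (lookup-map i (p *_) g) (lookup-⊛ v G i))

lookup-unit-≡ : (i : Fin n) → lookup (unit i) i ≡ 1ℙ
lookup-unit-≡ i with i ≟ i | lookup-≡-tabulate {x = unit i} refl i
... | yes _   | eq = eq
... | no  i≢i | _  = contradiction refl i≢i

lookup-unit-≢ : {i j : Fin n} → i ≢ j → lookup (unit i) j ≡ 0ℙ
lookup-unit-≢ {i = i} {j} i≢j with i ≟ j | lookup-≡-tabulate {x = unit i} refl j
... | yes i≡j | _  = contradiction i≡j i≢j
... | no  _   | eq = eq

unit-injective : {i j : Fin n} → unit i ≡ unit j → i ≡ j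
unit-injective {i = i} {j} eq with i ≟ j
... | yes i≡j = i≡j
... | no  i≢j with trans (sym (lookup-unit-≡ j)) (trans (cong (λ x → lookup x j) (sym eq)) (lookup-unit-≢ i≢j))
... | ()

unit-zero : unit zero ≡ 1ℙ ∷ 𝟎 {n}
unit-zero = lookup-ext λ where
  zero    → refl
  (suc j) → trans (lookup-unit-≢ {i = zero} {suc j} λ ()) (sym (lookup-replicate j 0ℙ))

unit-suc : (i : Fin n) → unit (suc i) ≡ 0ℙ ∷ unit i
unit-suc i = lookup-ext λ where
    zero    → refl
    (suc j) → eq j
  where
  eq : ∀ j → lookup (unit (suc i)) (suc j) ≡ lookup (unit i) j
  eq j with i ≟ j
  ... | yes refl = trans (lookup-unit-≡ (suc i)) (sym (lookup-unit-≡ i))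
  ... | no  i≢j  = trans (lookup-unit-≢ {j = suc j} λ where refl → i≢j refl) (sym (lookup-unit-≢ i≢j))

unit-∙ : (i : Fin n) (x : Word n) → unit i ∙ x ≡ lookup x i
unit-∙ zero    (p ∷ x) = trans (cong (_∙ (p ∷ x)) unit-zero)
  (trans (cong (p +_) (∙-zeroˡ x)) (ℙₚ.+-identityʳ p))
unit-∙ (suc i) (p ∷ x) = trans (cong (_∙ (p ∷ x)) (unit-suc i)) (unit-∙ i x)

spread-at : (J : Vec (Fin n) m) (a : Word m) → (∀ {i j} → lookup J i ≡ lookup J j → i ≡ j) →
            ∀ j → lookup (spread J a) (lookup J j) ≡ lookup a j
spread-at J a J-inj j
  with any? (λ i → lookup J i ≟ lookup J j) | lookup-≡-tabulate {x = spread J a} refl (lookup J j)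
... | yes (i , eq) | eq′ = trans eq′ (cong (lookup a) (J-inj eq))
... | no  ∄        | _   = contradiction (j , refl) ∄

spread-off : (J : Vec (Fin n) m) (a : Word m) {p : Fin n} → (∀ j → lookup J j ≢ p) →
             lookup (spread J a) p ≡ 0ℙ
spread-off J a {p} off
  with any? (λ i → lookup J i ≟ p) | lookup-≡-tabulate {x = spread J a} refl p
... | yes (i , eq) | _   = contradiction eq (off i)
... | no  _        | eq′ = eq′

-- Turns `spread` into a linear combination, so that inner products with it follow from `⊛-∙`. By
-- injectivity of `J`, the column of `map unit J` at `lookup J j` is `unit j`; every column outside
-- the positions listed in `J` is zero.
spread≡⊛ : (J : Vec (Fin n) m) (a : Word m) → (∀ {i j} → lookup J i ≡ lookup J j → i ≡ j) →
           spread J a ≡ a ⊛ map unit J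
spread≡⊛ {n} {m} J a J-inj = lookup-ext λ p → trans (entry p) (sym (lookup-⊛ a (map unit J) p))
  where
  open ≡-Reasoning
  column : Fin n → Word m
  column p = map (λ g → lookup g p) (map unit J)
  lookup-column : ∀ p i → lookup (column p) i ≡ lookup (unit (lookup J i)) p
  lookup-column p i = trans (lookup-map i (λ g → lookup g p) (map unit J))
    (cong (λ g → lookup g p) (lookup-map i unit J))
  column-at : ∀ j → column (lookup J j) ≡ unit j
  column-at j = lookup-ext λ i → trans (lookup-column (lookup J j) i) (eq i)
    where
    eq : ∀ i → lookup (unit (lookup J i)) (lookup J j) ≡ lookup (unit j) i
    eq i with j ≟ i
    ... | yes refl = trans (lookup-unit-≡ (lookup J i)) (sym (lookup-unit-≡ i))
    ... | no  j≢i  = trans (lookup-unit-≢ (j≢i ∘ sym ∘ J-inj)) (sym (lookup-unit-≢ j≢i))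
  column-off : ∀ {p} → (∀ j → lookup J j ≢ p) → column p ≡ 𝟎
  column-off {p} off = lookup-ext λ i → trans (lookup-column p i)
    (trans (lookup-unit-≢ (off i)) (sym (lookup-replicate i 0ℙ)))
  entry : ∀ p → lookup (spread J a) p ≡ a ∙ column p
  entry p with any? (λ j → lookup J j ≟ p)
  ... | yes (j , refl) = begin
    lookup (spread J a) (lookup J j)  ≡⟨ spread-at J a J-inj j ⟩
    lookup a j                        ≡⟨ unit-∙ j a ⟨
    unit j ∙ a                        ≡⟨ ∙-comm (unit j) a ⟩
    a ∙ unit j                        ≡⟨ cong (a ∙_) (column-at j) ⟨
    a ∙ column (lookup J j)           ∎
  ... | no ∄ = begin
    lookup (spread J a) p  ≡⟨ spread-off J a off ⟩
    0ℙ                     ≡⟨ ∙-zeroʳ a ⟨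
    a ∙ 𝟎                  ≡⟨ cong (a ∙_) (column-off off) ⟨
    a ∙ column p           ∎
    where
    off : ∀ j → lookup J j ≢ p
    off j eq = ∄ (j , eq)

spread-∙ : (J : Vec (Fin n) m) (a : Word m) → (∀ {i j} → lookup J i ≡ lookup J j → i ≡ j) →
           ∀ y → spread J a ∙ y ≡ a ∙ map (lookup y) J
spread-∙ J a J-inj y = begin
  spread J a ∙ y         ≡⟨ cong (_∙ y) (spread≡⊛ J a J-inj) ⟩
  (a ⊛ map unit J) ∙ y   ≡⟨ ⊛-∙ a (map unit J) y ⟩
  a ∙ (map unit J ⊡ y)   ≡⟨ cong (a ∙_) (lookup-ext λ i → trans
                              (trans (lookup-map i (_∙ y) (map unit J)) (cong (_∙ y) (lookup-map i unit J)))
                              (trans (unit-∙ (lookup J i) y) (sym (lookup-map i (lookup y) J)))) ⟩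
  a ∙ map (lookup y) J   ∎
  where open ≡-Reasoning

module _ {A : Ω m} (S : SystematicGenerator A) where
  open SystematicGenerator S
  open ≡-Reasoning

  information-injective : ∀ {i j} → lookup information i ≡ lookup information j → i ≡ j
  information-injective {i} {j} eq = unit-injective
    (trans (sym (identity i)) (trans (cong (λ p → map (λ g → lookup g p) matrix) eq) (identity j)))

  -- By systematic form, `v ⊛ matrix` reads `v` in the information positions. This is why the
  -- additional generator of a child type code is orthogonal to the rows of `extend matrix a`.
  spread-∙-⊛ : (a v : Word m) → spread information a ∙ (v ⊛ matrix) ≡ v ∙ a
  spread-∙-⊛ a v = begin
    spread information a ∙ (v ⊛ matrix)       ≡⟨ spread-∙ information a information-injective (v ⊛ matrix) ⟩
    a ∙ map (lookup (v ⊛ matrix)) information ≡⟨ cong (a ∙_) (lookup-ext eq) ⟩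
    a ∙ v                                     ≡⟨ ∙-comm a v ⟩
    v ∙ a                                     ∎
    where
    eq : ∀ j → lookup (map (lookup (v ⊛ matrix)) information) j ≡ lookup v j
    eq j = begin
      lookup (map (lookup (v ⊛ matrix)) information) j     ≡⟨ lookup-map j (lookup (v ⊛ matrix)) information ⟩
      lookup (v ⊛ matrix) (lookup information j)           ≡⟨ lookup-⊛ v matrix (lookup information j) ⟩
      v ∙ map (λ g → lookup g (lookup information j)) matrix ≡⟨ cong (v ∙_) (identity j) ⟩
      v ∙ unit j                                           ≡⟨ ∙-comm v (unit j) ⟩
      unit j ∙ v                                           ≡⟨ unit-∙ j v ⟩
      lookup v j                                           ∎

  spread-∙-self : (a : Word m) → spread information a ∙ spread information a ≡ parity (weight a)
  spread-∙-self a = begin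
    spread information a ∙ spread information a  ≡⟨ ∙-self (spread information a) ⟩
    spread information a ∙ replicate _ 1ℙ        ≡⟨ spread-∙ information a information-injective _ ⟩
    a ∙ map (lookup (replicate _ 1ℙ)) information ≡⟨ cong (a ∙_) (lookup-ext λ i → trans
                                                      (lookup-map i (lookup (replicate _ 1ℙ)) information)
                                                      (trans (lookup-replicate (lookup information i) 1ℙ) (sym (lookup-replicate i 1ℙ)))) ⟩
    a ∙ replicate _ 1ℙ                           ≡⟨ parity-weight a ⟨
    parity (weight a)                            ∎

-- The action of permutations on words and codes

lookup-act : (σ : Permutation′ n) (x : Word n) (i : Fin n) →
             lookup (act σ x) i ≡ lookup x (σ ⟨$⟩ˡ i)
lookup-act σ x i = lookup∘tabulate _ i

act-⊕ : (σ : Permutation′ n) (x y : Word n) → act σ (x ⊕ y) ≡ act σ x ⊕ act σ y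
act-⊕ σ x y = lookup-ext λ i → begin
  lookup (act σ (x ⊕ y)) i                            ≡⟨ lookup-act σ (x ⊕ y) i ⟩
  lookup (x ⊕ y) (σ ⟨$⟩ˡ i)                           ≡⟨ lookup-zipWith _+_ (σ ⟨$⟩ˡ i) x y ⟩
  lookup x (σ ⟨$⟩ˡ i) + lookup y (σ ⟨$⟩ˡ i)           ≡⟨ cong₂ _+_ (lookup-act σ x i) (lookup-act σ y i) ⟨
  lookup (act σ x) i + lookup (act σ y) i             ≡⟨ lookup-zipWith _+_ i (act σ x) (act σ y) ⟨
  lookup (act σ x ⊕ act σ y) i                        ∎
  where open ≡-Reasoning

act-𝟎 : (σ : Permutation′ n) → act σ 𝟎 ≡ 𝟎
act-𝟎 σ = lookup-ext λ i → trans (lookup-act σ 𝟎 i)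
  (trans (lookup-replicate (σ ⟨$⟩ˡ i) 0ℙ) (sym (lookup-replicate i 0ℙ)))

act-⊛ : (σ : Permutation′ n) (v : Word m) (G : Matrix m n) → act σ (v ⊛ G) ≡ v ⊛ map (act σ) G
act-⊛ σ = map-⊛ (act σ) (act-𝟎 σ , act-⊕ σ)

act-∘ : (σ τ : Permutation′ n) (x : Word n) → act (σ ∘ₚ τ) x ≡ act τ (act σ x)
act-∘ σ τ x = tabulate-cong λ i → sym (lookup-act σ x (τ ⟨$⟩ˡ i))

act-flipˡ : (σ : Permutation′ n) (x : Word n) → act (flip σ) (act σ x) ≡ x
act-flipˡ σ x = lookup-ext λ i → trans (lookup-act (flip σ) (act σ x) i)
  (trans (lookup-act σ x (σ ⟨$⟩ʳ i)) (cong (lookup x) (inverseˡ σ)))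

act-flipʳ : (σ : Permutation′ n) (x : Word n) → act σ (act (flip σ) x) ≡ x
act-flipʳ σ x = act-flipˡ (flip σ) x

∙≡sum : (x y : Word n) → x ∙ y ≡ sum λ i → lookup x i * lookup y i
∙≡sum []      []      = refl
∙≡sum (p ∷ x) (q ∷ y) = cong (p * q +_) (∙≡sum x y)

act-∙ : (σ : Permutation′ n) (x y : Word n) → act σ x ∙ act σ y ≡ x ∙ y
act-∙ {n} σ x y = begin
  act σ x ∙ act σ y                                         ≡⟨ ∙≡sum (act σ x) (act σ y) ⟩
  sum (λ i → lookup (act σ x) i * lookup (act σ y) i)       ≡⟨ sum-cong-≗ {n = n} (λ i →
                                                                 cong₂ _*_ (lookup-act σ x i) (lookup-act σ y i)) ⟩
  sum (λ i → lookup x (σ ⟨$⟩ˡ i) * lookup y (σ ⟨$⟩ˡ i))     ≡⟨ sum-permute (λ i → lookup x i * lookup y i) (flip σ) ⟨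
  sum (λ i → lookup x i * lookup y i)                       ≡⟨ ∙≡sum x y ⟨
  x ∙ y                                                     ∎
  where
  open ≡-Reasoning

Image-∘ : {σ τ : Permutation′ n} {C D E : Pred (Word n) 0ℓ} →
          Image σ C ≐ D → Image τ D ≐ E → Image (σ ∘ₚ τ) C ≐ E
Image-∘ {σ = σ} {τ} (σC⊆D , D⊆σC) (τD⊆E , E⊆τD) =
    (λ where (x , x∈C , refl) → τD⊆E (act σ x , σC⊆D (x , x∈C , refl) , act-∘ σ τ x))
  , λ z∈E → case E⊆τD z∈E of λ where
      (y , y∈D , refl) → case D⊆σC y∈D of λ where
        (x , x∈C , refl) → x , x∈C , sym (act-∘ σ τ x)

Image-flip : {σ : Permutation′ n} {C D : Pred (Word n) 0ℓ} →
             Image σ C ≐ D → Image (flip σ) D ≐ C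
Image-flip {σ = σ} {C} {D} (σC⊆D , D⊆σC) = to ,
  λ {x} x∈C → act σ x , σC⊆D (x , x∈C , refl) , sym (act-flipˡ σ x)
  where
  to : Image (flip σ) D ⊆ C
  to (y , y∈D , refl) with D⊆σC y∈D
  ... | x , x∈C , refl = subst C (sym (act-flipˡ σ x)) x∈C

Image-respˡ : {σ : Permutation′ n} {C D E : Pred (Word n) 0ℓ} →
              C ≐ D → Image σ C ≐ E → Image σ D ≐ E
Image-respˡ (C⊆D , D⊆C) (σC⊆E , E⊆σC) =
    (λ (x , x∈D , eq) → σC⊆E (x , D⊆C x∈D , eq))
  , λ y∈E → case E⊆σC y∈E of λ (x , x∈C , eq) → x , C⊆D x∈C , eq

-- Words with two appended coordinates

∷ʳ-⊕ : (x y : Word n) (p q : F₂) → (x ∷ʳ p) ⊕ (y ∷ʳ q) ≡ x ⊕ y ∷ʳ p + q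
∷ʳ-⊕ []      []      p q = refl
∷ʳ-⊕ (r ∷ x) (s ∷ y) p q = cong (r + s ∷_) (∷ʳ-⊕ x y p q)

∷ʳ-∙ : (x y : Word n) (p q : F₂) → (x ∷ʳ p) ∙ (y ∷ʳ q) ≡ x ∙ y + p * q
∷ʳ-∙ []      []      p q = ℙₚ.+-identityʳ (p * q)
∷ʳ-∙ (r ∷ x) (s ∷ y) p q = trans (cong (r * s +_) (∷ʳ-∙ x y p q)) (sym (ℙₚ.+-assoc (r * s) (x ∙ y) (p * q)))

∷ʳ²-⊕ : (x y : Word n) (p q r s : F₂) →
        (x ∷ʳ p ∷ʳ q) ⊕ (y ∷ʳ r ∷ʳ s) ≡ x ⊕ y ∷ʳ p + r ∷ʳ q + s
∷ʳ²-⊕ x y p q r s = trans (∷ʳ-⊕ (x ∷ʳ p) (y ∷ʳ r) q s) (cong (_∷ʳ q + s) (∷ʳ-⊕ x y p r))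

∷ʳ²-∙ : (x y : Word n) (p q r s : F₂) →
        (x ∷ʳ p ∷ʳ q) ∙ (y ∷ʳ r ∷ʳ s) ≡ x ∙ y + p * r + q * s
∷ʳ²-∙ x y p q r s = trans (∷ʳ-∙ (x ∷ʳ p) (y ∷ʳ r) q s) (cong (_+ q * s) (∷ʳ-∙ x y p r))

∷ʳ²-injective : {x y : Word n} {p q r s : F₂} →
                x ∷ʳ p ∷ʳ q ≡ y ∷ʳ r ∷ʳ s → x ≡ y × p ≡ r × q ≡ s
∷ʳ²-injective {x = x} {y} {p} {q} {r} {s} eq with ∷ʳ-injective (x ∷ʳ p) (y ∷ʳ r) eq
... | eq′ , q≡s with ∷ʳ-injective x y eq′
... | x≡y , p≡r = x≡y , p≡r , q≡s

initLast² : (x : Word (suc (suc n))) → ∃ λ y → ∃₂ λ p q → x ≡ y ∷ʳ p ∷ʳ q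
initLast² x with initLast x
... | x′ , q , refl with initLast x′
... | y , p , refl = y , p , q , refl

𝟎-∷ʳ : ∀ n → 𝟎 {suc n} ≡ 𝟎 {n} ∷ʳ 0ℙ
𝟎-∷ʳ zero    = refl
𝟎-∷ʳ (suc n) = cong (0ℙ ∷_) (𝟎-∷ʳ n)

𝟎-∷ʳ² : ∀ n → 𝟎 {suc (suc n)} ≡ 𝟎 {n} ∷ʳ 0ℙ ∷ʳ 0ℙ
𝟎-∷ʳ² n = trans (𝟎-∷ʳ (suc n)) (cong (_∷ʳ 0ℙ) (𝟎-∷ʳ n))

·-∷ʳ² : (c : F₂) (x : Word n) (p q : F₂) → c · (x ∷ʳ p ∷ʳ q) ≡ c · x ∷ʳ c * p ∷ʳ c * q
·-∷ʳ² c x p q = trans (map-∷ʳ (c *_) q (x ∷ʳ p)) (cong (_∷ʳ c * q) (map-∷ʳ (c *_) p x))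

⊛-extend : (v : Word m) (G : Matrix m n) (a : Word m) →
           v ⊛ extend G a ≡ v ⊛ G ∷ʳ v ∙ a ∷ʳ v ∙ a
⊛-extend []      []      []      = 𝟎-∷ʳ² _
⊛-extend (c ∷ v) (g ∷ G) (p ∷ a) = trans
  (cong₂ _⊕_ (·-∷ʳ² c g p p) (⊛-extend v G a))
  (∷ʳ²-⊕ (c · g) (v ⊛ G) (c * p) (c * p) (v ∙ a) (v ∙ a))

data Position {n} : Fin (suc (suc n)) → Set where
  inner  : ∀ i → Position (inject₁ (inject₁ i))
  penult : Position penultimate
  ult    : Position ultimate

position : (i : Fin (suc (suc n))) → Position i
position i with view i
... | ‵fromℕ = ult
... | ‵inject₁ j with view j
...   | ‵fromℕ     = penult
...   | ‵inject₁ k = inner k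

lookup-∷ʳ-fromℕ : (x : Word n) (p : F₂) → lookup (x ∷ʳ p) (fromℕ n) ≡ p
lookup-∷ʳ-fromℕ []      p = refl
lookup-∷ʳ-fromℕ (q ∷ x) p = lookup-∷ʳ-fromℕ x p

lookup-∷ʳ-inject₁ : (x : Word n) (p : F₂) (i : Fin n) → lookup (x ∷ʳ p) (inject₁ i) ≡ lookup x i
lookup-∷ʳ-inject₁ (q ∷ x) p zero    = refl
lookup-∷ʳ-inject₁ (q ∷ x) p (suc i) = lookup-∷ʳ-inject₁ x p i

module _ (x : Word n) (p q : F₂) where

  lookup-ultimate : lookup (x ∷ʳ p ∷ʳ q) ultimate ≡ q
  lookup-ultimate = lookup-∷ʳ-fromℕ (x ∷ʳ p) q

  lookup-penultimate : lookup (x ∷ʳ p ∷ʳ q) penultimate ≡ p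
  lookup-penultimate = trans (lookup-∷ʳ-inject₁ (x ∷ʳ p) q (fromℕ n)) (lookup-∷ʳ-fromℕ x p)

  lookup-inner : ∀ i → lookup (x ∷ʳ p ∷ʳ q) (inject₁ (inject₁ i)) ≡ lookup x i
  lookup-inner i = trans (lookup-∷ʳ-inject₁ (x ∷ʳ p) q (inject₁ i)) (lookup-∷ʳ-inject₁ x p i)

∷ʳ²-ext : {z : Word (suc (suc n))} {x : Word n} {p q : F₂} →
          (∀ i → lookup z (inject₁ (inject₁ i)) ≡ lookup x i) →
          lookup z penultimate ≡ p → lookup z ultimate ≡ q → z ≡ x ∷ʳ p ∷ʳ q
∷ʳ²-ext {z = z} {x} {p} {q} eq-inner eq-penult eq-ult = lookup-ext λ i → eq (position i)
  where
  eq : ∀ {i} → Position i → lookup z i ≡ lookup (x ∷ʳ p ∷ʳ q) i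
  eq (inner i) = trans (eq-inner i) (sym (lookup-inner x p q i))
  eq penult    = trans eq-penult (sym (lookup-penultimate x p q))
  eq ult       = trans eq-ult (sym (lookup-ultimate x p q))

-- Permutations preserving the last two coordinates

-- The two cases are ordered as in `PassesParentTest`, whose condition is then definitionally
-- `PreservesLastTwo (flip φ ∘ₚ σ)`.
PreservesLastTwo : Permutation′ (suc (suc n)) → Set
PreservesLastTwo σ =
    (σ ⟨$⟩ʳ ultimate ≡ ultimate    × σ ⟨$⟩ʳ penultimate ≡ penultimate)
  ⊎ (σ ⟨$⟩ʳ ultimate ≡ penultimate × σ ⟨$⟩ʳ penultimate ≡ ultimate)

flip-⟨$⟩ : (σ : Permutation′ n) {i j : Fin n} → σ ⟨$⟩ʳ i ≡ j → σ ⟨$⟩ˡ j ≡ i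
flip-⟨$⟩ σ eq = trans (cong (σ ⟨$⟩ˡ_) (sym eq)) (inverseˡ σ)

PreservesLastTwo-flip : (σ : Permutation′ (suc (suc n))) → PreservesLastTwo σ → PreservesLastTwo (flip σ)
PreservesLastTwo-flip σ (inj₁ (u , p)) = inj₁ (flip-⟨$⟩ σ u , flip-⟨$⟩ σ p)
PreservesLastTwo-flip σ (inj₂ (u , p)) = inj₂ (flip-⟨$⟩ σ p , flip-⟨$⟩ σ u)

PreservesLastTwo-∘ : (σ τ : Permutation′ (suc (suc n))) →
                     PreservesLastTwo σ → PreservesLastTwo τ → PreservesLastTwo (σ ∘ₚ τ)
PreservesLastTwo-∘ σ τ (inj₁ (u , p)) (inj₁ (u′ , p′)) =
  inj₁ (trans (cong (τ ⟨$⟩ʳ_) u) u′ , trans (cong (τ ⟨$⟩ʳ_) p) p′)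
PreservesLastTwo-∘ σ τ (inj₁ (u , p)) (inj₂ (u′ , p′)) =
  inj₂ (trans (cong (τ ⟨$⟩ʳ_) u) u′ , trans (cong (τ ⟨$⟩ʳ_) p) p′)
PreservesLastTwo-∘ σ τ (inj₂ (u , p)) (inj₁ (u′ , p′)) =
  inj₂ (trans (cong (τ ⟨$⟩ʳ_) u) p′ , trans (cong (τ ⟨$⟩ʳ_) p) u′)
PreservesLastTwo-∘ σ τ (inj₂ (u , p)) (inj₂ (u′ , p′)) =
  inj₁ (trans (cong (τ ⟨$⟩ʳ_) u) p′ , trans (cong (τ ⟨$⟩ʳ_) p) u′)

inner≢penultimate : {i : Fin n} → inject₁ (inject₁ i) ≢ penultimate
inner≢penultimate eq = fromℕ≢inject₁ (sym (inject₁-injective eq))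

inner≢ultimate : {i : Fin (suc n)} → inject₁ i ≢ ultimate
inner≢ultimate eq = fromℕ≢inject₁ (sym eq)

-- The last two positions already have their preimages among themselves, so by injectivity no inner
-- position reaches them.
inner-inner : (σ : Permutation′ (suc (suc n))) → PreservesLastTwo σ →
              ∀ i → ∃ λ j → σ ⟨$⟩ʳ inject₁ (inject₁ i) ≡ inject₁ (inject₁ j)
inner-inner σ σ-last i with σ ⟨$⟩ʳ inject₁ (inject₁ i) in eq
... | i′ with position i′
... | inner j = j , refl
inner-inner σ (inj₁ (u , p)) i | _ | penult =
  contradiction (trans (sym (flip-⟨$⟩ σ eq)) (flip-⟨$⟩ σ p)) inner≢penultimate
inner-inner σ (inj₂ (u , p)) i | _ | penult =
  contradiction (trans (sym (flip-⟨$⟩ σ eq)) (flip-⟨$⟩ σ u)) inner≢ultimate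
inner-inner σ (inj₁ (u , p)) i | _ | ult =
  contradiction (trans (sym (flip-⟨$⟩ σ eq)) (flip-⟨$⟩ σ u)) inner≢ultimate
inner-inner σ (inj₂ (u , p)) i | _ | ult =
  contradiction (trans (sym (flip-⟨$⟩ σ eq)) (flip-⟨$⟩ σ p)) inner≢penultimate

module _ (σ : Permutation′ (suc (suc n))) (σ-last : PreservesLastTwo σ) where

  private
    to from : Fin n → Fin n
    to   i = proj₁ (inner-inner σ σ-last i)
    from i = proj₁ (inner-inner (flip σ) (PreservesLastTwo-flip σ σ-last) i)

    to-inner : ∀ i → σ ⟨$⟩ʳ inject₁ (inject₁ i) ≡ inject₁ (inject₁ (to i))
    to-inner i = proj₂ (inner-inner σ σ-last i)

    from-inner : ∀ i → σ ⟨$⟩ˡ inject₁ (inject₁ i) ≡ inject₁ (inject₁ (from i))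
    from-inner i = proj₂ (inner-inner (flip σ) (PreservesLastTwo-flip σ σ-last) i)

  restrict : Permutation′ n
  restrict = permutation to from
    (λ i → inject₁-injective (inject₁-injective
      (trans (sym (to-inner (from i))) (trans (cong (σ ⟨$⟩ʳ_) (sym (from-inner i))) (inverseʳ σ)))))
    (λ i → inject₁-injective (inject₁-injective
      (trans (sym (from-inner (to i))) (trans (cong (σ ⟨$⟩ˡ_) (sym (to-inner i))) (inverseˡ σ)))))

  -- With equal last entries it makes no difference whether `σ` fixes or swaps the last two
  -- positions.
  act-restrict : (x : Word n) (p : F₂) → act σ (x ∷ʳ p ∷ʳ p) ≡ act restrict x ∷ʳ p ∷ʳ p
  act-restrict x p = ∷ʳ²-ext
    (λ i → begin
      lookup (act σ (x ∷ʳ p ∷ʳ p)) (inject₁ (inject₁ i))       ≡⟨ lookup-act σ (x ∷ʳ p ∷ʳ p) _ ⟩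
      lookup (x ∷ʳ p ∷ʳ p) (σ ⟨$⟩ˡ inject₁ (inject₁ i))        ≡⟨ cong (lookup (x ∷ʳ p ∷ʳ p)) (from-inner i) ⟩
      lookup (x ∷ʳ p ∷ʳ p) (inject₁ (inject₁ (from i)))        ≡⟨ lookup-inner x p p (from i) ⟩
      lookup x (from i)                                        ≡⟨ lookup-act restrict x i ⟨
      lookup (act restrict x) i                                ∎)
    (trans (lookup-act σ (x ∷ʳ p ∷ʳ p) penultimate) (proj₁ (lasts (PreservesLastTwo-flip σ σ-last))))
    (trans (lookup-act σ (x ∷ʳ p ∷ʳ p) ultimate) (proj₂ (lasts (PreservesLastTwo-flip σ σ-last))))
    where
    open ≡-Reasoning
    z = x ∷ʳ p ∷ʳ p
    lasts : PreservesLastTwo (flip σ) →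
            lookup z (σ ⟨$⟩ˡ penultimate) ≡ p × lookup z (σ ⟨$⟩ˡ ultimate) ≡ p
    lasts (inj₁ (u , q)) = trans (cong (lookup z) q) (lookup-penultimate x p p)
                         , trans (cong (lookup z) u) (lookup-ultimate x p p)
    lasts (inj₂ (u , q)) = trans (cong (lookup z) q) (lookup-ultimate x p p)
                         , trans (cong (lookup z) u) (lookup-penultimate x p p)

module _ (f : Fin n → Fin n) where

  liftLast : Fin (suc n) → Fin (suc n)
  liftLast i with view i
  ... | ‵fromℕ     = fromℕ n
  ... | ‵inject₁ j = inject₁ (f j)

  liftLast-fromℕ : liftLast (fromℕ n) ≡ fromℕ n
  liftLast-fromℕ rewrite view-fromℕ n = refl

  liftLast-inject₁ : ∀ i → liftLast (inject₁ i) ≡ inject₁ (f i)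
  liftLast-inject₁ i rewrite view-inject₁ i = refl

liftLast-inverse : {f g : Fin n → Fin n} → (∀ i → f (g i) ≡ i) →
                   ∀ i → liftLast f (liftLast g i) ≡ i
liftLast-inverse {f = f} {g} inv i with view i
... | ‵fromℕ     = liftLast-fromℕ f
... | ‵inject₁ j = trans (liftLast-inject₁ f (g j)) (cong inject₁ (inv j))

lift : Permutation′ n → Permutation′ (suc n)
lift σ = permutation (liftLast (σ ⟨$⟩ʳ_)) (liftLast (σ ⟨$⟩ˡ_))
  (liftLast-inverse {g = σ ⟨$⟩ˡ_} λ _ → inverseʳ σ) (liftLast-inverse {g = σ ⟨$⟩ʳ_} λ _ → inverseˡ σ)

act-lift : (σ : Permutation′ n) (x : Word n) (p : F₂) → act (lift σ) (x ∷ʳ p) ≡ act σ x ∷ʳ p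
act-lift {n} σ x p = lookup-ext λ i → trans (lookup-act (lift σ) (x ∷ʳ p) i) (eq i)
  where
  eq : ∀ i → lookup (x ∷ʳ p) (liftLast (σ ⟨$⟩ˡ_) i) ≡ lookup (act σ x ∷ʳ p) i
  eq i with view i
  ... | ‵fromℕ     = trans (lookup-∷ʳ-fromℕ x p) (sym (lookup-∷ʳ-fromℕ (act σ x) p))
  ... | ‵inject₁ j = trans (lookup-∷ʳ-inject₁ x p (σ ⟨$⟩ˡ j))
    (sym (trans (lookup-∷ʳ-inject₁ (act σ x) p j) (lookup-act σ x j)))

lift² : Permutation′ n → Permutation′ (suc (suc n))
lift² σ = lift (lift σ)

act-lift² : (σ : Permutation′ n) (x : Word n) (p q : F₂) →
            act (lift² σ) (x ∷ʳ p ∷ʳ q) ≡ act σ x ∷ʳ p ∷ʳ q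
act-lift² σ x p q = trans (act-lift (lift σ) (x ∷ʳ p) q) (cong (_∷ʳ q) (act-lift σ x p))

lift²-PreservesLastTwo : (σ : Permutation′ n) → PreservesLastTwo (lift² σ)
lift²-PreservesLastTwo {n} σ = inj₁
  ( liftLast-fromℕ (liftLast (σ ⟨$⟩ʳ_))
  , trans (liftLast-inject₁ (liftLast (σ ⟨$⟩ʳ_)) (fromℕ n)) (cong inject₁ (liftLast-fromℕ (σ ⟨$⟩ʳ_))))

transpose-≡ˡ : (i j : Fin n) → transpose i j ⟨$⟩ʳ i ≡ j
transpose-≡ˡ i j with i ≟ i
... | yes _   = refl
... | no  i≢i = contradiction refl i≢i

transpose-≡ʳ : (i j : Fin n) → transpose i j ⟨$⟩ʳ j ≡ i
transpose-≡ʳ i j with j ≟ i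
... | yes j≡i = j≡i
... | no  _ with j ≟ j
...   | yes _   = refl
...   | no  j≢j = contradiction refl j≢j

transpose-≢ : {i j k : Fin n} → k ≢ i → k ≢ j → transpose i j ⟨$⟩ʳ k ≡ k
transpose-≢ {i = i} {j} {k} k≢i k≢j with k ≟ i
... | yes k≡i = contradiction k≡i k≢i
... | no  _ with k ≟ j
...   | yes k≡j = contradiction k≡j k≢j
...   | no  _   = refl

swapLastTwo : Permutation′ (suc (suc n))
swapLastTwo = transpose penultimate ultimate

swapLastTwo-PreservesLastTwo : ∀ {n} → PreservesLastTwo (swapLastTwo {n})
swapLastTwo-PreservesLastTwo = inj₂ (transpose-≡ʳ penultimate ultimate , transpose-≡ˡ penultimate ultimate)

act-swapLastTwo : (x : Word n) (p q : F₂) → act swapLastTwo (x ∷ʳ p ∷ʳ q) ≡ x ∷ʳ q ∷ʳ p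
act-swapLastTwo {n} x p q = ∷ʳ²-ext
    (λ i → trans (lookup-act swapLastTwo z (inject₁ (inject₁ i))) (trans
      -- `act` evaluates the inverse permutation, and the inverse of `transpose i j` is given by
      -- `transpose j i`; hence the reversed arguments.
      (cong (lookup z) (transpose-≢ {i = ultimate} {penultimate} inner≢ultimate inner≢penultimate))
      (lookup-inner x p q i)))
    (trans (lookup-act swapLastTwo z penultimate)
      (trans (cong (lookup z) (transpose-≡ʳ ultimate penultimate)) (lookup-ultimate x p q)))
    (trans (lookup-act swapLastTwo z ultimate)
      (trans (cong (lookup z) (transpose-≡ˡ ultimate penultimate)) (lookup-penultimate x p q)))
  where
  z = x ∷ʳ p ∷ʳ q

-- Images and shortenings of self-dual codes

+≡0⇒≡ : ∀ p {q} → p + q ≡ 0ℙ → q ≡ p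
+≡0⇒≡ 0ℙ      eq = eq
+≡0⇒≡ 1ℙ {1ℙ} eq = refl

≡⊎≡⁻¹ : ∀ p q → q ≡ p ⊎ q ≡ p ⁻¹
≡⊎≡⁻¹ 0ℙ 0ℙ = inj₁ refl
≡⊎≡⁻¹ 0ℙ 1ℙ = inj₂ refl
≡⊎≡⁻¹ 1ℙ 0ℙ = inj₂ refl
≡⊎≡⁻¹ 1ℙ 1ℙ = inj₁ refl

⁻¹-+ : ∀ p q → p ⁻¹ + q ≡ (p + q) ⁻¹
⁻¹-+ 0ℙ q = refl
⁻¹-+ 1ℙ q = sym (ℙₚ.⁻¹-involutive q)

⁻¹-+-⁻¹ : ∀ p q → p ⁻¹ + q ⁻¹ ≡ p + q
⁻¹-+-⁻¹ 0ℙ q = ℙₚ.⁻¹-involutive q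
⁻¹-+-⁻¹ 1ℙ q = refl

-- Duality reverses inclusions: `D` is its own dual, which lies in the dual of `C`, which is `C`.
selfDual-⊆ : (C D : Ω m) → words C ⊆ words D → words C ≐ words D
selfDual-⊆ C D C⊆D = C⊆D ,
  λ x∈D → proj₂ (Ω.selfDual C) λ y∈C → proj₁ (Ω.selfDual D) x∈D (C⊆D y∈C)

image : Permutation′ (m ℕ.* 2) → Ω m → Ω m
image {m} σ C = record
  { code      = record
    { words    = Image σ (words C)
    ; 𝟎∈       = 𝟎 , Ω.𝟎∈ C , sym (act-𝟎 σ)
    ; ⊕-closed = λ where
        (x , x∈C , refl) (y , y∈C , refl) → x ⊕ y , Ω.⊕-closed C x∈C y∈C , sym (act-⊕ σ x y)
    }
  ; dimension = dimension
  ; selfDual  = (λ where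
        (x , x∈C , refl) (y , y∈C , refl) → trans (act-∙ σ x y) (proj₁ (Ω.selfDual C) x∈C y∈C))
      , λ {z} z∈Dual → act (flip σ) z , proj₂ (Ω.selfDual C) (dual z z∈Dual) , sym (act-flipʳ σ z)
  }
  where
  open ≡-Reasoning
  dual : ∀ z → Dual (Image σ (words C)) z → Dual (words C) (act (flip σ) z)
  dual z z∈Dual {y} y∈C = begin
    act (flip σ) z ∙ y                    ≡⟨ act-∙ σ (act (flip σ) z) y ⟨
    act σ (act (flip σ) z) ∙ act σ y      ≡⟨ cong (_∙ act σ y) (act-flipʳ σ z) ⟩
    z ∙ act σ y                           ≡⟨ z∈Dual (y , y∈C , refl) ⟩
    0ℙ                                    ∎
  dimension : HasDimension (Image σ (words C)) m
  dimension with Ω.dimension C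
  ... | G , (G⊆C , C⊆G) , ind =
      map (act σ) G
    , ( (λ where (v , refl) → v ⊛ G , G⊆C (v , refl) , sym (act-⊛ σ v G))
      , λ where (x , x∈C , refl) → case C⊆G x∈C of λ where (v , refl) → v , act-⊛ σ v G)
    , λ v eq → ind v (begin
        v ⊛ G                              ≡⟨ act-flipˡ σ (v ⊛ G) ⟨
        act (flip σ) (act σ (v ⊛ G))       ≡⟨ cong (act (flip σ)) (trans (act-⊛ σ v G) eq) ⟩
        act (flip σ) 𝟎                     ≡⟨ act-𝟎 (flip σ) ⟩
        𝟎                                  ∎)

∷ʳ²-diagonal-∙ : (x y : Word n) (p q r : F₂) →
                 (x ∷ʳ p ∷ʳ p) ∙ (y ∷ʳ q ∷ʳ r) ≡ x ∙ y + p * (q + r)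
∷ʳ²-diagonal-∙ x y p q r = trans (∷ʳ²-∙ x y p p q r)
  (trans (ℙₚ.+-assoc (x ∙ y) (p * q) (p * r)) (cong (x ∙ y +_) (sym (ℙₚ.*-distribˡ-+ p q r))))

diagonal-diagonal : (x y : Word n) (p q : F₂) → (x ∷ʳ p ∷ʳ p) ∙ (y ∷ʳ q ∷ʳ q) ≡ x ∙ y
diagonal-diagonal x y p q = trans (∷ʳ²-diagonal-∙ x y p q q) (trans
  (cong (λ r → x ∙ y + p * r) (ℙₚ.p+p≡0ℙ q))
  (trans (cong (x ∙ y +_) (ℙₚ.*-zeroʳ p)) (ℙₚ.+-identityʳ (x ∙ y))))

-- Orthogonality of two such words forces `p ≡ x ∙ y`; appended entries are determined in this way
-- throughout.
diagonal-antidiagonal : (x y : Word n) (p q : F₂) → (x ∷ʳ p ∷ʳ p) ∙ (y ∷ʳ q ∷ʳ q ⁻¹) ≡ x ∙ y + p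
diagonal-antidiagonal x y p q = trans (∷ʳ²-diagonal-∙ x y p q (q ⁻¹))
  (cong (x ∙ y +_) (trans (cong (p *_) (ℙₚ.p+p⁻¹≡1ℙ q)) (ℙₚ.*-identityʳ p)))

Shortened : Pred (Word (suc (suc n))) 0ℓ → Pred (Word n) 0ℓ
Shortened C x = ∃[ p ] (x ∷ʳ p ∷ʳ p) ∈ C

-- A positive form of `¬ EqualCoordinates C penultimate ultimate`: the arguments below compute with
-- an actual word whose last two entries differ.
Separated : Pred (Word (suc (suc n))) 0ℓ → Set
Separated C = ∃₂ λ y p → (y ∷ʳ p ∷ʳ p ⁻¹) ∈ C

shortened-selfDual : (R : Ω (suc m)) → Separated (words R) →
                     Shortened (words R) ≐ Dual (Shortened (words R))
shortened-selfDual R (y , a , y∈R) = to , from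
  where
  open ≡-Reasoning
  to : Shortened (words R) ⊆ Dual (Shortened (words R))
  to {x} (p , x∈R) {z} (q , z∈R) = trans (sym (diagonal-diagonal x z p q)) (proj₁ (Ω.selfDual R) x∈R z∈R)
  from : Dual (Shortened (words R)) ⊆ Shortened (words R)
  -- The appended value `x ∙ y` makes the word orthogonal to the separating word. Any other word of
  -- `R` with different last entries becomes one with equal last entries on adding the separating
  -- word.
  from {x} x∈Dual = x ∙ y , proj₂ (Ω.selfDual R) λ {z} z∈R → dual z z∈R
    where
    dual : ∀ z → z ∈ words R → (x ∷ʳ x ∙ y ∷ʳ x ∙ y) ∙ z ≡ 0ℙ
    dual z z∈R with initLast² z
    ... | w , c , d , refl with ≡⊎≡⁻¹ c d
    ... | inj₁ refl = trans (diagonal-diagonal x w (x ∙ y) c) (x∈Dual (c , z∈R))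
    ... | inj₂ refl = begin
      (x ∷ʳ x ∙ y ∷ʳ x ∙ y) ∙ (w ∷ʳ c ∷ʳ c ⁻¹)  ≡⟨ diagonal-antidiagonal x w (x ∙ y) c ⟩
      x ∙ w + x ∙ y                             ≡⟨ ∙-distribˡ x w y ⟨
      x ∙ (w ⊕ y)                               ≡⟨ x∈Dual (c + a , subst (words R) eq (Ω.⊕-closed R z∈R y∈R)) ⟩
      0ℙ                                        ∎
      where
      eq : (w ∷ʳ c ∷ʳ c ⁻¹) ⊕ (y ∷ʳ a ∷ʳ a ⁻¹) ≡ w ⊕ y ∷ʳ c + a ∷ʳ c + a
      eq = trans (∷ʳ²-⊕ w y c (c ⁻¹) a (a ⁻¹)) (cong (w ⊕ y ∷ʳ c + a ∷ʳ_) (⁻¹-+-⁻¹ c a))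

-- The inner product with this word is the sum of the last two entries, which vanishes exactly when
-- they are equal.
lastTwoOnes : Word (suc (suc n))
lastTwoOnes = 𝟎 ∷ʳ 1ℙ ∷ʳ 1ℙ

∙-lastTwoOnes : (x : Word n) (p q : F₂) → (x ∷ʳ p ∷ʳ q) ∙ lastTwoOnes ≡ p + q
∙-lastTwoOnes x p q = trans (∙-comm (x ∷ʳ p ∷ʳ q) lastTwoOnes)
  (trans (∷ʳ²-diagonal-∙ 𝟎 x 1ℙ p q) (cong (_+ (p + q)) (∙-zeroˡ x)))

truncate : Word (suc (suc n)) → Word n
truncate = init ∘ init

truncate-∷ʳ² : (x : Word n) (p q : F₂) → truncate (x ∷ʳ p ∷ʳ q) ≡ x
truncate-∷ʳ² x p q = trans (cong init (init-∷ʳ q (x ∷ʳ p))) (init-∷ʳ p x)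

truncate-linear : IsLinear (truncate {n})
truncate-linear {n} = trans (cong truncate (𝟎-∷ʳ² n)) (truncate-∷ʳ² 𝟎 0ℙ 0ℙ) , additive
  where
  additive : ∀ x y → truncate (x ⊕ y) ≡ truncate x ⊕ truncate y
  additive x y with initLast² x | initLast² y
  ... | x′ , p , q , refl | y′ , r , s , refl = trans
    (trans (cong truncate (∷ʳ²-⊕ x′ y′ p q r s)) (truncate-∷ʳ² (x′ ⊕ y′) (p + r) (q + s)))
    (sym (cong₂ _⊕_ (truncate-∷ʳ² x′ p q) (truncate-∷ʳ² y′ r s)))

diagonal : (x : Word (suc (suc n))) → x ∙ lastTwoOnes ≡ 0ℙ → ∃ λ p → x ≡ truncate x ∷ʳ p ∷ʳ p
diagonal x eq with initLast² x
... | y , p , q , refl with +≡0⇒≡ p (trans (sym (∙-lastTwoOnes y p q)) eq)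
... | refl = p , cong (λ z → z ∷ʳ p ∷ʳ p) (sym (truncate-∷ʳ² y p p))

equalLastTwo : {C : Pred (Word (suc (suc n))) 0ℓ} → (∀ {x} → x ∈ C → x ∙ lastTwoOnes ≡ 0ℙ) →
               EqualCoordinates C penultimate ultimate
equalLastTwo orth {x} x∈C with initLast² x
... | y , p , q , refl = trans (lookup-penultimate y p q)
  (trans (sym (+≡0⇒≡ p (trans (sym (∙-lastTwoOnes y p q)) (orth x∈C)))) (sym (lookup-ultimate y p q)))

module _ (R : Ω (suc m)) {G : Matrix (suc m) (suc m ℕ.* 2)}
         (G-spans : Span G ≐ words R) (P : Pivoted lastTwoOnes G) where
  open Pivoted P
  open ≡-Reasoning

  pivoted-separated : Separated (words R)
  pivoted-separated with initLast² pivot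
  ... | y , p , q , eq with ≡⊎≡⁻¹ p q
  ... | inj₂ refl = y , p , subst (words R) eq
          (proj₁ G-spans (proj₁ spans (1ℙ ∷ 𝟎 , sym (head-⊛ pivot rest))))
  ... | inj₁ refl with trans (sym pivot∙u≡1) (trans (cong (_∙ lastTwoOnes) eq)
                          (trans (∙-lastTwoOnes y p p) (ℙₚ.p+p≡0ℙ p)))
  ... | ()

  rest-∙ : ∀ v → (v ⊛ rest) ∙ lastTwoOnes ≡ 0ℙ
  rest-∙ v = trans (⊛-∙ v rest lastTwoOnes) (trans (cong (v ∙_) rest⊡u≡𝟎) (∙-zeroʳ v))

  rest-∈ : ∀ v → (v ⊛ rest) ∈ words R
  rest-∈ v = proj₁ G-spans (proj₁ spans (Span-tail {g = pivot} (v , refl)))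

  -- The words of `R` with equal last entries are spanned by `rest`, because a contribution of
  -- `pivot` would make these entries different. Truncation is injective on them: the only nonzero
  -- candidate for its kernel is `lastTwoOnes`, which is not orthogonal to the separating word.
  pivoted-dimension : HasDimension (Shortened (words R)) m
  pivoted-dimension = map truncate rest , (to , from) , independent′
    where
    truncated : ∀ v → truncate (v ⊛ rest) ≡ v ⊛ map truncate rest
    truncated v = map-⊛ truncate truncate-linear v rest
    to : Span (map truncate rest) ⊆ Shortened (words R)
    to (v , refl) with diagonal (v ⊛ rest) (rest-∙ v)
    ... | p , eq = p , subst (words R) (trans eq (cong (λ z → z ∷ʳ p ∷ʳ p) (truncated v))) (rest-∈ v)
    from : Shortened (words R) ⊆ Span (map truncate rest)
    from {x} (p , x∈R) with proj₂ spans (proj₂ G-spans x∈R)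
    ... | 0ℙ ∷ v , eq = v , (begin
      x                                       ≡⟨ truncate-∷ʳ² x p p ⟨
      truncate (x ∷ʳ p ∷ʳ p)                  ≡⟨ cong truncate (trans eq (tail-⊛ v pivot rest)) ⟩
      truncate (v ⊛ rest)                     ≡⟨ truncated v ⟩
      v ⊛ map truncate rest                   ∎)
    ... | 1ℙ ∷ v , eq = case absurd of λ ()
      where
      absurd : 0ℙ ≡ 1ℙ
      absurd = begin
        0ℙ                                                ≡⟨ trans (∙-lastTwoOnes x p p) (ℙₚ.p+p≡0ℙ p) ⟨
        (x ∷ʳ p ∷ʳ p) ∙ lastTwoOnes                       ≡⟨ cong (_∙ lastTwoOnes) eq ⟩
        (1ℙ · pivot ⊕ v ⊛ rest) ∙ lastTwoOnes             ≡⟨ ∙-distribʳ (1ℙ · pivot) (v ⊛ rest) lastTwoOnes ⟩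
        (1ℙ · pivot) ∙ lastTwoOnes + (v ⊛ rest) ∙ lastTwoOnes
          ≡⟨ cong₂ _+_ (trans (cong (_∙ lastTwoOnes) (·-identityˡ pivot)) pivot∙u≡1) (rest-∙ v) ⟩
        1ℙ                                                ∎
    independent′ : LinearlyIndependent (map truncate rest)
    independent′ v eq with diagonal (v ⊛ rest) (rest-∙ v) | pivoted-separated
    ... | p , eq′ | y , q , y∈R = proj₂ (∷-injective (independent (0ℙ ∷ v) (begin
        (0ℙ ∷ v) ⊛ (pivot ∷ rest)       ≡⟨ tail-⊛ v pivot rest ⟩
        v ⊛ rest                        ≡⟨ v⊛rest ⟩
        𝟎 ∷ʳ p ∷ʳ p                     ≡⟨ cong (λ r → 𝟎 ∷ʳ r ∷ʳ r) p≡0 ⟩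
        𝟎 ∷ʳ 0ℙ ∷ʳ 0ℙ                   ≡⟨ 𝟎-∷ʳ² _ ⟨
        𝟎                               ∎)))
      where
      v⊛rest : v ⊛ rest ≡ 𝟎 ∷ʳ p ∷ʳ p
      v⊛rest = trans eq′ (cong (λ z → z ∷ʳ p ∷ʳ p) (trans (truncated v) eq))
      p≡0 : p ≡ 0ℙ
      p≡0 = begin
        p                                        ≡⟨ cong (_+ p) (∙-zeroˡ y) ⟨
        𝟎 ∙ y + p                                ≡⟨ diagonal-antidiagonal 𝟎 y p q ⟨
        (𝟎 ∷ʳ p ∷ʳ p) ∙ (y ∷ʳ q ∷ʳ q ⁻¹)         ≡⟨ proj₁ (Ω.selfDual R) (subst (words R) v⊛rest (rest-∈ v)) y∈R ⟩
        0ℙ                                       ∎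

-- A negated hypothesis yields a witness because `pivoting` decides on a generator matrix whether
-- the sum of the last two entries vanishes on all of `R`.
shorten : (R : Ω (suc m)) → ¬ EqualCoordinates (words R) penultimate ultimate →
          Separated (words R) × ∃ λ (A : Ω m) → words A ≡ Shortened (words R)
shorten R unequal with Ω.dimension R
... | G , G-spans , ind with pivoting lastTwoOnes G ind
... | inj₁ G⊡u≡𝟎 = ⊥-elim (unequal (equalLastTwo {C = words R} orth))
  where
  orth : ∀ {x} → x ∈ words R → x ∙ lastTwoOnes ≡ 0ℙ
  orth x∈R with proj₂ G-spans x∈R
  ... | v , refl = trans (⊛-∙ v G lastTwoOnes) (trans (cong (v ∙_) G⊡u≡𝟎) (∙-zeroʳ v))
... | inj₂ P = separated , record
  { code      = record
    { words    = Shortened (words R)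
    ; 𝟎∈       = 0ℙ , subst (words R) (𝟎-∷ʳ² _) (Ω.𝟎∈ R)
    ; ⊕-closed = closed
    }
  ; dimension = pivoted-dimension R G-spans P
  ; selfDual  = shortened-selfDual R separated
  } , refl
  where
  separated = pivoted-separated R G-spans P
  closed : ∀ {x y} → x ∈ Shortened (words R) → y ∈ Shortened (words R) → (x ⊕ y) ∈ Shortened (words R)
  closed {x} {y} (p , x∈R) (q , y∈R) =
    p + q , subst (words R) (∷ʳ²-⊕ x y p p q q) (Ω.⊕-closed R x∈R y∈R)

Extends : Matrix m n → Word m → Pred (Word (suc (suc n))) 0ℓ → Set
Extends G a C = ∀ v → (v ⊛ G ∷ʳ v ∙ a ∷ʳ v ∙ a) ∈ C

-- For each row of `G`, the entry of `a` is the common last entry of some word of `C` lying above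
-- that row; closure under sums handles all combinations.
extending : (C : LinearCode (suc (suc n))) (G : Matrix m n) →
            Span G ⊆ Shortened (LinearCode.words C) → ∃ λ a → Extends G a (LinearCode.words C)
extending C []      G⊆C = [] , λ where
  [] → subst (LinearCode.words C) (𝟎-∷ʳ² _) (LinearCode.𝟎∈ C)
extending C (g ∷ G) G⊆C with extending C G (λ x∈G → G⊆C (Span-tail {g = g} x∈G))
                           | G⊆C (1ℙ ∷ 𝟎 , sym (head-⊛ g G))
... | a , a-ext | p , g∈C = p ∷ a , λ where
    (0ℙ ∷ v) → subst (λ z → LinearCode.words C (z ∷ʳ v ∙ a ∷ʳ v ∙ a)) (sym (tail-⊛ v g G)) (a-ext v)
    (1ℙ ∷ v) → subst (λ z → LinearCode.words C (z ⊕ v ⊛ G ∷ʳ p + v ∙ a ∷ʳ p + v ∙ a)) (sym (·-identityˡ g))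
      (subst (LinearCode.words C) (∷ʳ²-⊕ g (v ⊛ G) p p (v ∙ a) (v ∙ a)) (LinearCode.⊕-closed C g∈C (a-ext v)))

-- Child type codes and the parent test

module _ {A : Ω m} (S : SystematicGenerator A) (B : Ω (suc m)) {a : Word m} where
  open SystematicGenerator S
  open ≡-Reasoning

  private
    x = spread information a

  ⊥-rows : Extends matrix a (words B) → {y : Word (m ℕ.* 2)} {p : F₂} →
           (y ∷ʳ p ∷ʳ p ⁻¹) ∈ words B → ∀ v → y ∙ (v ⊛ matrix) ≡ v ∙ a
  ⊥-rows a-ext {y} {p} y∈B v = trans (∙-comm y (v ⊛ matrix)) (+≡0⇒≡ (v ∙ a) (begin
    v ∙ a + (v ⊛ matrix) ∙ y       ≡⟨ ℙₚ.+-comm (v ∙ a) _ ⟩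
    (v ⊛ matrix) ∙ y + v ∙ a       ≡⟨ diagonal-antidiagonal (v ⊛ matrix) y (v ∙ a) p ⟨
    _                              ≡⟨ proj₁ (Ω.selfDual B) (a-ext v) y∈B ⟩
    0ℙ                             ∎))

  dual-matrix : {y : Word (m ℕ.* 2)} → (∀ v → y ∙ (v ⊛ matrix) ≡ 0ℙ) → ∃ λ v → y ≡ v ⊛ matrix
  dual-matrix orth = proj₂ (proj₁ generates) (proj₂ (Ω.selfDual A) λ z∈A →
    case proj₂ (proj₁ generates) z∈A of λ where (v , refl) → orth v)

  -- The separating word `y` and `x` have the same inner product `v ∙ a` with each `v ⊛ matrix`, so
  -- `y ⊕ x` lies in the dual of `A`, that is, in `A`. Adding the extension of this codeword
  -- replaces `y` by `x` and keeps the last entries different.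
  spread∈ : Extends matrix a (words B) → Separated (words B) → ∃ λ p → (x ∷ʳ p ∷ʳ p ⁻¹) ∈ words B
  spread∈ a-ext (y , p , y∈B) with dual-matrix {y ⊕ x} (λ v → begin
      (y ⊕ x) ∙ (v ⊛ matrix)                 ≡⟨ ∙-distribʳ y x (v ⊛ matrix) ⟩
      y ∙ (v ⊛ matrix) + x ∙ (v ⊛ matrix)    ≡⟨ cong₂ _+_ (⊥-rows a-ext y∈B v) (spread-∙-⊛ S a v) ⟩
      v ∙ a + v ∙ a                          ≡⟨ ℙₚ.p+p≡0ℙ (v ∙ a) ⟩
      0ℙ                                     ∎)
  ... | v , eq = p + v ∙ a , subst (words B) (begin
      (y ∷ʳ p ∷ʳ p ⁻¹) ⊕ (v ⊛ matrix ∷ʳ v ∙ a ∷ʳ v ∙ a)  ≡⟨ ∷ʳ²-⊕ y (v ⊛ matrix) p (p ⁻¹) (v ∙ a) (v ∙ a) ⟩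
      y ⊕ v ⊛ matrix ∷ʳ p + v ∙ a ∷ʳ p ⁻¹ + v ∙ a        ≡⟨ cong₂ (λ z r → z ∷ʳ p + v ∙ a ∷ʳ r)
                                                              (trans (cong (y ⊕_) (sym eq)) (⊕-cancelˡ y x)) (⁻¹-+ p (v ∙ a)) ⟩
      x ∷ʳ p + v ∙ a ∷ʳ (p + v ∙ a) ⁻¹                   ∎) (Ω.⊕-closed B y∈B (a-ext v))

  -- The word is orthogonal to itself, and its last two entries contribute 1.
  spread∈⇒odd : {p : F₂} → (x ∷ʳ p ∷ʳ p ⁻¹) ∈ words B → OddWeight a
  spread∈⇒odd {p} x∈B = +≡0⇒≡ 1ℙ (begin
    1ℙ + parity (weight a)                       ≡⟨ ℙₚ.+-comm 1ℙ (parity (weight a)) ⟩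
    parity (weight a) + 1ℙ                       ≡⟨ cong₂ _+_ (spread-∙-self S a) (p*p+p⁻¹*p⁻¹≡1 p) ⟨
    x ∙ x + (p * p + p ⁻¹ * p ⁻¹)                ≡⟨ ℙₚ.+-assoc (x ∙ x) (p * p) (p ⁻¹ * p ⁻¹) ⟨
    x ∙ x + p * p + p ⁻¹ * p ⁻¹                  ≡⟨ ∷ʳ²-∙ x x p (p ⁻¹) p (p ⁻¹) ⟨
    _                                            ≡⟨ proj₁ (Ω.selfDual B) x∈B x∈B ⟩
    0ℙ                                           ∎)
    where
    p*p+p⁻¹*p⁻¹≡1 : ∀ p → p * p + p ⁻¹ * p ⁻¹ ≡ 1ℙ
    p*p+p⁻¹*p⁻¹≡1 0ℙ = refl
    p*p+p⁻¹*p⁻¹≡1 1ℙ = refl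

  -- For a word of `B` with equal last entries, orthogonality to the extended rows puts its first
  -- part in `A`, and orthogonality to the word of `x` fixes the appended value. All other words
  -- reduce to these by adding the word of `x`.
  ≐-childWords : Extends matrix a (words B) → (x ∷ʳ 1ℙ ∷ʳ 0ℙ) ∈ words B → words B ≐ childWords S a
  ≐-childWords a-ext x∈B = to , from
    where
    row∈ : ∀ v → (v ⊛ extend matrix a) ∈ words B
    row∈ v = subst (words B) (sym (⊛-extend v matrix a)) (a-ext v)
    from : childWords S a ⊆ words B
    from (0ℙ ∷ v , refl) = subst (words B) (sym (tail-⊛ v (x ∷ʳ 1ℙ ∷ʳ 0ℙ) (extend matrix a))) (row∈ v)
    from (1ℙ ∷ v , refl) = subst (λ z → words B (z ⊕ v ⊛ extend matrix a))
      (sym (·-identityˡ (x ∷ʳ 1ℙ ∷ʳ 0ℙ))) (Ω.⊕-closed B x∈B (row∈ v))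
    diagonal∈ : ∀ {w p} → (w ∷ʳ p ∷ʳ p) ∈ words B → ∃ λ v → w ∷ʳ p ∷ʳ p ≡ v ⊛ extend matrix a
    diagonal∈ {w} {p} w∈B with dual-matrix {w} (λ v → trans (∙-comm w (v ⊛ matrix))
        (trans (sym (diagonal-diagonal (v ⊛ matrix) w (v ∙ a) p)) (proj₁ (Ω.selfDual B) (a-ext v) w∈B)))
    ... | v , refl = v , trans (cong (λ q → w ∷ʳ q ∷ʳ q) p≡v∙a) (sym (⊛-extend v matrix a))
      where
      p≡v∙a : p ≡ v ∙ a
      p≡v∙a = +≡0⇒≡ (v ∙ a) (begin
        v ∙ a + p                                 ≡⟨ cong (_+ p) (trans (∙-comm w x) (spread-∙-⊛ S a v)) ⟨
        w ∙ x + p                                 ≡⟨ diagonal-antidiagonal w x p 1ℙ ⟨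
        (w ∷ʳ p ∷ʳ p) ∙ (x ∷ʳ 1ℙ ∷ʳ 0ℙ)           ≡⟨ proj₁ (Ω.selfDual B) w∈B x∈B ⟩
        0ℙ                                        ∎)
    to : words B ⊆ childWords S a
    to {z} z∈B with initLast² z
    ... | w , p , q , refl with ≡⊎≡⁻¹ p q
    ... | inj₁ refl = Span-tail {g = x ∷ʳ 1ℙ ∷ʳ 0ℙ} (diagonal∈ z∈B)
    ... | inj₂ refl with diagonal∈ {x ⊕ w} {p ⁻¹} (subst (words B)
                           (∷ʳ²-⊕ x w 1ℙ 0ℙ p (p ⁻¹)) (Ω.⊕-closed B x∈B z∈B))
    ... | v , eq = (1ℙ ∷ v) , (begin
      w ∷ʳ p ∷ʳ p ⁻¹                                           ≡⟨ ⊕-cancelˡ (x ∷ʳ 1ℙ ∷ʳ 0ℙ) _ ⟨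
      (x ∷ʳ 1ℙ ∷ʳ 0ℙ) ⊕ ((x ∷ʳ 1ℙ ∷ʳ 0ℙ) ⊕ (w ∷ʳ p ∷ʳ p ⁻¹))   ≡⟨ cong₂ _⊕_ (sym (·-identityˡ (x ∷ʳ 1ℙ ∷ʳ 0ℙ)))
                                                                    (trans (∷ʳ²-⊕ x w 1ℙ 0ℙ p (p ⁻¹)) eq) ⟩
      (1ℙ ∷ v) ⊛ ((x ∷ʳ 1ℙ ∷ʳ 0ℙ) ∷ extend matrix a)           ∎)

module _ {A : Ω m} (S : SystematicGenerator A) {a : Word m} where
  open SystematicGenerator S
  open ≡-Reasoning

  childWords-extends : Extends matrix a (childWords S a)
  childWords-extends v = (0ℙ ∷ v) , trans (sym (⊛-extend v matrix a))
    (sym (tail-⊛ v (spread information a ∷ʳ 1ℙ ∷ʳ 0ℙ) (extend matrix a)))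

  childWords-diagonal : ∀ {w p} → (w ∷ʳ p ∷ʳ p) ∈ childWords S a →
                        ∃ λ v → w ≡ v ⊛ matrix × p ≡ v ∙ a
  childWords-diagonal {w} {p} (0ℙ ∷ v , eq)
    with ∷ʳ²-injective (trans eq (trans (tail-⊛ v (spread information a ∷ʳ 1ℙ ∷ʳ 0ℙ) (extend matrix a))
                                         (⊛-extend v matrix a)))
  ... | w≡ , p≡ , _ = v , w≡ , p≡
  childWords-diagonal {w} {p} (1ℙ ∷ v , eq)
    with ∷ʳ²-injective (trans eq (trans
           (cong₂ _⊕_ (·-identityˡ (spread information a ∷ʳ 1ℙ ∷ʳ 0ℙ)) (⊛-extend v matrix a))
           (∷ʳ²-⊕ (spread information a) (v ⊛ matrix) 1ℙ 0ℙ (v ∙ a) (v ∙ a))))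
  -- Using the generator that ends in 1, 0 would make the last entries `(v ∙ a) ⁻¹` and `v ∙ a`.
  ... | _ , refl , p≡ = contradiction (sym p≡) (ℙₚ.p≢p⁻¹ (v ∙ a))

childWords-cong : {A B : Ω m} (S : SystematicGenerator A) (T : SystematicGenerator B) {a b : Word m} →
                  SystematicGenerator.matrix S ≡ SystematicGenerator.matrix T →
                  SystematicGenerator.information S ≡ SystematicGenerator.information T →
                  a ≡ b → childWords S a ≡ childWords T b
childWords-cong S T matrix≡ information≡ refl =
  cong₂ (λ J G → Span ((spread J _ ∷ʳ 1ℙ ∷ʳ 0ℙ) ∷ extend G _)) information≡ matrix≡

-- Equivalence by permutations preserving the last two coordinates

infix 4 _≅ₗ_

_≅ₗ_ : Pred (Word (suc (suc n))) 0ℓ → Pred (Word (suc (suc n))) 0ℓ → Set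
C ≅ₗ D = ∃ λ σ → PreservesLastTwo σ × Image σ C ≐ D

≅ₗ-sym : {C D : Pred (Word (suc (suc n))) 0ℓ} → C ≅ₗ D → D ≅ₗ C
≅ₗ-sym (σ , σ-last , σC≐D) = flip σ , PreservesLastTwo-flip σ σ-last , Image-flip {σ = σ} σC≐D

≅ₗ-trans : {C D E : Pred (Word (suc (suc n))) 0ℓ} → C ≅ₗ D → D ≅ₗ E → C ≅ₗ E
≅ₗ-trans (σ , σ-last , σC≐D) (τ , τ-last , τD≐E) =
  σ ∘ₚ τ , PreservesLastTwo-∘ σ τ σ-last τ-last , Image-∘ {σ = σ} {τ} σC≐D τD≐E

≅ₗ-respˡ : {C D E : Pred (Word (suc (suc n))) 0ℓ} → C ≐ D → C ≅ₗ E → D ≅ₗ E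
≅ₗ-respˡ C≐D (σ , σ-last , σC≐E) = σ , σ-last , Image-respˡ {σ = σ} C≐D σC≐E

≅ₗ-Image : {C : Pred (Word (suc (suc n))) 0ℓ} (σ : Permutation′ (suc (suc n))) →
           PreservesLastTwo σ → C ≅ₗ Image σ C
≅ₗ-Image σ σ-last = σ , σ-last , (λ z → z) , (λ z → z)

module _ (B : Ω (suc m)) {D : Pred (Word (suc m ℕ.* 2)) 0ℓ} (φ : Permutation′ (suc m ℕ.* 2))
         (φB≐D : Image φ (words B) ≐ D) where

  -- Passing to `σ` after the inverse of `φ` turns an automorphism of `B` into a map from `D` to
  -- `B`; the converse composes `κ` after `φ`. Here `D` is any set of words equal to the canonical
  -- form, so it may come from an equivalent code.
  passes⇒≅ₗ : PassesParentTest B φ → D ≅ₗ words B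
  passes⇒≅ₗ (σ , σ-aut , σ-last) =
    flip φ ∘ₚ σ , σ-last , Image-∘ {σ = flip φ} {σ} (Image-flip {σ = φ} φB≐D) σ-aut

  ≅ₗ⇒passes : D ≅ₗ words B → PassesParentTest B φ
  ≅ₗ⇒passes (κ , κ-last , κD≐B) = φ ∘ₚ κ , Image-∘ {σ = φ} {κ} φB≐D κD≐B , last κ-last
    where
    c : ∀ {i j} → κ ⟨$⟩ʳ i ≡ j → κ ⟨$⟩ʳ (φ ⟨$⟩ʳ (φ ⟨$⟩ˡ i)) ≡ j
    c eq = trans (cong (κ ⟨$⟩ʳ_) (inverseʳ φ)) eq
    last : PreservesLastTwo κ → PreservesLastTwo (flip φ ∘ₚ φ ∘ₚ κ)
    last (inj₁ (u , p)) = inj₁ (c u , c p)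
    last (inj₂ (u , p)) = inj₂ (c u , c p)

lift²-∈ : {C : Pred (Word (suc (suc n))) 0ℓ} (σ : Permutation′ n) {x : Word n} {p q : F₂} →
          (x ∷ʳ p ∷ʳ q) ∈ C → (act σ x ∷ʳ p ∷ʳ q) ∈ Image (lift² σ) C
lift²-∈ σ {x} {p} {q} x∈C = x ∷ʳ p ∷ʳ q , x∈C , sym (act-lift² σ x p q)

swapLastTwo-∈ : {C : Pred (Word (suc (suc n))) 0ℓ} {x : Word n} {p q : F₂} →
                (x ∷ʳ p ∷ʳ q) ∈ C → (x ∷ʳ q ∷ʳ p) ∈ Image swapLastTwo C
swapLastTwo-∈ {x = x} {p} {q} x∈C = x ∷ʳ p ∷ʳ q , x∈C , sym (act-swapLastTwo x p q)

lift²-separated : {C : Pred (Word (suc (suc n))) 0ℓ} (σ : Permutation′ n) →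
                  Separated C → Separated (Image (lift² σ) C)
lift²-separated σ (y , p , y∈C) = act σ y , p , lift²-∈ σ y∈C

-- The word (x|01) in place of (x|10) is corrected by swapping the last two coordinates.
≅ₗ-childWords : {A : Ω m} (S : SystematicGenerator A) (B : Ω (suc m)) {a : Word m} →
                Extends (SystematicGenerator.matrix S) a (words B) → Separated (words B) →
                ∃ λ C → words C ≐ childWords S a × words B ≅ₗ words C
≅ₗ-childWords S B {a} a-ext sep with spread∈ S B a-ext sep
... | 0ℙ , x∈B = image swapLastTwo B
               , ≐-childWords S (image swapLastTwo B) (λ v → swapLastTwo-∈ (a-ext v)) (swapLastTwo-∈ x∈B)
               , ≅ₗ-Image swapLastTwo swapLastTwo-PreservesLastTwo
... | 1ℙ , x∈B = image id B
               , ≐-childWords S (image id B) (λ v → id-∈ (a-ext v)) (id-∈ x∈B)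
               , ≅ₗ-Image id (inj₁ (refl , refl))
  where
  id-∈ : words B ⊆ Image id (words B)
  id-∈ {x} x∈B = x , x∈B , sym (tabulate∘lookup x)

-- Apply the hypothesis to `v ⊛ M`. Since `M ⊗ matrix` is the permuted matrix, the inverse of `P`
-- carries the first part back to `v ⊛ matrix`, while the appended value is
-- `(v ⊛ M) ∙ a ≡ v ∙ (M ⊡ a)`.
Extends-sameOrbit : {A : Ω m} (S : SystematicGenerator A) (B : Ω (suc m)) {a b : Word m} →
                    Extends (SystematicGenerator.matrix S) a (words B) →
                    ((P , _) : SameOrbit S a b) →
                    Extends (SystematicGenerator.matrix S) b (words (image (lift² (flip P)) B))
Extends-sameOrbit S B {a} {b} a-ext (P , _ , M , PG≡MG , b≡Ma) v =
  subst₂ (λ y p → (y ∷ʳ p ∷ʳ p) ∈ words (image (lift² (flip P)) B)) y≡ p≡ (lift²-∈ (flip P) (a-ext (v ⊛ M)))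
  where
  open SystematicGenerator S
  open ≡-Reasoning
  y≡ : act (flip P) ((v ⊛ M) ⊛ matrix) ≡ v ⊛ matrix
  y≡ = begin
    act (flip P) ((v ⊛ M) ⊛ matrix)        ≡⟨ cong (act (flip P)) (⊛-⊗ v M matrix) ⟨
    act (flip P) (v ⊛ (M ⊗ matrix))        ≡⟨ cong (λ G → act (flip P) (v ⊛ G)) PG≡MG ⟨
    act (flip P) (v ⊛ map (act P) matrix)  ≡⟨ cong (act (flip P)) (act-⊛ P v matrix) ⟨
    act (flip P) (act P (v ⊛ matrix))      ≡⟨ act-flipˡ P (v ⊛ matrix) ⟩
    v ⊛ matrix                             ∎
  p≡ : (v ⊛ M) ∙ a ≡ v ∙ b
  p≡ = trans (⊛-∙ v M a) (cong (v ∙_) (sym b≡Ma))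

-- The rows of `M` are the solutions for the unit vectors, so the same `M` serves both equations.
factor : (G : Matrix m n) (H : Matrix k n) (a : Word m) (b : Word k) →
         (∀ v → ∃ λ w → v ⊛ G ≡ w ⊛ H × v ∙ a ≡ w ∙ b) →
         ∃ λ M → G ≡ M ⊗ H × a ≡ M ⊡ b
factor []      H []      b sol = [] , refl , refl
factor (g ∷ G) H (p ∷ a) b sol
  with sol (1ℙ ∷ 𝟎)
     | factor G H a b (λ v → case sol (0ℙ ∷ v) of λ (w , eq , eq′) → w , trans (sym (tail-⊛ v g G)) eq , eq′)
... | w , eq , eq′ | M , G≡ , a≡ =
    w ∷ M
  , cong₂ _∷_ (trans (sym (head-⊛ g G)) eq) G≡
  , cong₂ _∷_ (trans (sym (trans (cong (p +_) (∙-zeroˡ a)) (ℙₚ.+-identityʳ p))) eq′) a≡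

module _ {A A′ : Ω m} (S : SystematicGenerator A) (S′ : SystematicGenerator A′) {a a′ : Word m}
         (iso : childWords S a ≅ₗ childWords S′ a′) where
  open SystematicGenerator S
  open SystematicGenerator S′ using () renaming (matrix to matrix′; generates to generates′)

  private
    P : Permutation′ (m ℕ.* 2)
    P = restrict (proj₁ iso) (proj₁ (proj₂ iso))

    rows : ∀ v → ∃ λ w → act P (v ⊛ matrix) ≡ w ⊛ matrix′ × v ∙ a ≡ w ∙ a′
    rows v = childWords-diagonal S′ (proj₁ (proj₂ (proj₂ iso))
      ( v ⊛ matrix ∷ʳ v ∙ a ∷ʳ v ∙ a , childWords-extends S v
      , sym (act-restrict (proj₁ iso) (proj₁ (proj₂ iso)) (v ⊛ matrix) (v ∙ a))))

    -- `rows` gives one inclusion only; self-duality of both codes supplies the other.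
    PA≐A′ : Image P (words A) ≐ words A′
    PA≐A′ = selfDual-⊆ (image P A) A′ λ where
      (x , x∈A , refl) → case proj₂ (proj₁ generates) x∈A of λ where
        (v , refl) → case rows v of λ (w , eq , _) → subst (words A′) (sym eq)
          (proj₁ (proj₁ generates′) (w , refl))

  children-parents : A ≅ A′
  children-parents = P , PA≐A′

  -- The permutation sends each extended row to a word with the same appended value, so the matrix
  -- expressing `P` on the generators also expresses `a` through `a′`; hence the order of the two
  -- vectors.
  children-sameOrbit : words A ≐ words A′ → matrix ≡ matrix′ → SameOrbit S′ a′ a
  children-sameOrbit A≐A′ matrix≡ =
    P , Image-respˡ {σ = P} A≐A′ PA≐A′ ,
    subst (λ G → ∃ λ M → map (act P) G ≡ M ⊗ matrix′ × a ≡ M ⊡ a′) matrix≡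
      (factor (map (act P) matrix) matrix′ a a′
        λ v → case rows v of λ (w , eq , eq′) → w , trans (sym (act-⊛ P v matrix)) eq , eq′)

-- Children up to permutations preserving the last two coordinates

module _ (choices : ChildChoices) where
  open ChildChoices choices

  -- A vector `a` read off from `R` has odd weight, so its orbit has a representative `t`. Moving
  -- `R` by the inverse of the corresponding automorphism of `A` replaces `a` by `t`.
  child-covers : (A : Ω m) (R : Ω (suc m)) → Separated (words R) → words A ⊆ Shortened (words R) →
                 ∃ λ B → B ∈ Child A × words R ≅ₗ words B
  child-covers A R sep A⊆R =
    case extending (Ω.code R) (matrix A) (λ x∈G → A⊆R (proj₁ (proj₁ (generates A)) x∈G)) of λ (a , a-ext) →
    case spread∈ (systematic A) R a-ext sep of λ (_ , x∈R) →
    case IsOrbitTransversal.meets (isTransversal A) (spread∈⇒odd (systematic A) R x∈R) of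
      λ (t , t∈T , orbit@(P , _)) →
    case ≅ₗ-childWords (systematic A) (image (lift² (flip P)) R)
           (Extends-sameOrbit (systematic A) R a-ext orbit) (lift²-separated (flip P) sep) of
      λ (B , B≐ , R′≅B) →
    B , (t , t∈T , B≐) , ≅ₗ-trans (≅ₗ-Image (lift² (flip P)) (lift²-PreservesLastTwo (flip P))) R′≅B

  -- Undoing `σ` on the first coordinates of `R` brings `A` itself into the shortened code.
  child-covers-image : (A : Ω m) (R : Ω (suc m)) (σ : Permutation′ (m ℕ.* 2)) → Separated (words R) →
                       Image σ (words A) ⊆ Shortened (words R) →
                       ∃ λ B → B ∈ Child A × words R ≅ₗ words B
  child-covers-image A R σ sep σA⊆R =
    case child-covers A (image (lift² (flip σ)) R) (lift²-separated (flip σ) sep) A⊆ of λ (B , B∈ , R′≅B) →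
    B , B∈ , ≅ₗ-trans (≅ₗ-Image (lift² (flip σ)) (lift²-PreservesLastTwo (flip σ))) R′≅B
    where
    A⊆ : words A ⊆ Shortened (Image (lift² (flip σ)) (words R))
    A⊆ {x} x∈A =
      let p , x∈R = σA⊆R (x , x∈A , refl)
      in  p , subst (λ y → (y ∷ʳ p ∷ʳ p) ∈ Image (lift² (flip σ)) (words R)) (act-flipˡ σ x)
                (lift²-∈ (flip σ) x∈R)

  module _ {A A′ : Ω m} {B B′ : Ω (suc m)} (B∈ : B ∈ Child A) (B′∈ : B′ ∈ Child A′)
           (B≅B′ : words B ≅ₗ words B′) where

    private
      a  = proj₁ B∈
      a′ = proj₁ B′∈

      iso : childWords (systematic A) a ≅ₗ childWords (systematic A′) a′
      iso = ≅ₗ-sym (≅ₗ-respˡ (proj₂ (proj₂ B′∈)) (≅ₗ-sym (≅ₗ-respˡ (proj₂ (proj₂ B∈)) B≅B′)))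

    parents-≅ : A ≅ A′
    parents-≅ = children-parents (systematic A) (systematic A′) iso

    children-≐ : words A ≐ words A′ → words B ≐ words B′
    children-≐ A≐A′ = ≐-trans (proj₂ (proj₂ B∈)) (subst (_≐ words B′)
      (sym (childWords-cong (systematic A) (systematic A′)
        (matrix-cong {A = A} {A′} A≐A′) (information-cong {A = A} {A′} A≐A′) (sym a′≡a)))
      (≐-sym (proj₂ (proj₂ B′∈))))
      where
      a′≡a : a′ ≡ a
      -- Equal parents have the same choices, so both vectors are representatives in the one
      -- transversal of `A′`.
      a′≡a = IsOrbitTransversal.unique (isTransversal A′) (proj₁ (proj₂ B′∈))
        (proj₁ (transversal-cong {A = A} {A′} A≐A′) (proj₁ (proj₂ B∈)))
        (children-sameOrbit (systematic A) (systematic A′) iso A≐A′ (matrix-cong {A = A} {A′} A≐A′))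

-- The output of the algorithm

module _ {s : ℕ} .{{_ : NonZero s}} (reps : CanonicalRepresentatives) (φ : CanonicalPermutations reps)
         (choices : ChildChoices) {ℓ : Level} (U : Pred (Ω s) ℓ) where
  open CanonicalRepresentatives reps
  open ChildChoices choices
  open Algorithm reps φ choices

  AcceptedChild : Pred (Ω (suc s)) _
  AcceptedChild B = ∃ λ A → A ∈ U × B ∈ Child A × PassesParentTest B (proj₁ (φ B))

  -- Exactly one augmentation takes place: `add` at dimension `s` is ruled out by its index, and a
  -- second augmentation would need `suc s` to be less than itself.
  output⇒acceptedChild : Output U (suc s) ⊆ AcceptedChild
  output⇒acceptedChild (A , A∈U , augment _ B∈ pass add)                = A , A∈U , B∈ , pass
  output⇒acceptedChild (A , A∈U , augment _ B∈ pass (augment s<s _ _ _)) = contradiction s<s (<-irrefl refl)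

  acceptedChild⇒output : AcceptedChild ⊆ Output U (suc s)
  acceptedChild⇒output (A , A∈U , B∈ , pass) = A , A∈U , augment (n<1+n s) B∈ pass add

  outputs-≐ : ConsistsOfAllInequivalent U → {B B′ : Ω (suc s)} →
              B ∈ AcceptedChild → B′ ∈ AcceptedChild → B ≅ B′ → words B ≐ words B′
  outputs-≐ U-all {B} {B′} (A , A∈U , B∈ , pass) (A′ , A′∈U , B′∈ , pass′) B≅B′ =
    children-≐ choices {A = A} {A′} {B} {B′} B∈ B′∈ B≅ₗB′
      (ConsistsOfAllInequivalent.atMostOne U-all A∈U A′∈U
        (parents-≅ choices {A = A} {A′} {B} {B′} B∈ B′∈ B≅ₗB′))
    where
    B≅ₗB′ : words B ≅ₗ words B′
    -- From `B` to `ρ B`, which has the same words as `ρ B′`, and on to `B′`.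
    B≅ₗB′ = ≅ₗ-trans (≅ₗ-sym (passes⇒≅ₗ B (proj₁ (φ B)) (proj₂ (φ B)) pass))
      (≅ₗ-respˡ (≐-sym (ρ-invariant {X = B} {B′} B≅B′))
        (passes⇒≅ₗ B′ (proj₁ (φ B′)) (proj₂ (φ B′)) pass′))

  outputs-cover : ConsistsOfAllInequivalent U → ∀ B → ∃ λ C → C ∈ AcceptedChild × C ≅ B
  outputs-cover U-all B =
    case shorten (ρ B) (ρ-lastTwo B) of λ (sep , A₀ , A₀≡) →
    case ConsistsOfAllInequivalent.atLeastOne U-all A₀ of λ (A , A∈U , σ , σA≐A₀) →
    case child-covers-image choices A (ρ B) σ sep
           (λ {x} x∈σA → subst (x ∈_) A₀≡ (proj₁ σA≐A₀ x∈σA)) of λ (C , C∈ , ρB≅ₗC) →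
    -- The canonical permutation of `C` leads to `ρ C`, whereas `C` was obtained from `ρ B`; the
    -- equivalence of `C` and `B` identifies the two sets of words.
    C , (A , A∈U , C∈ , ≅ₗ⇒passes C (proj₁ (φ C))
          (≐-trans (proj₂ (φ C)) (ρ-invariant {X = C} {B} (≅ₗρ⇒≅ C ρB≅ₗC))) ρB≅ₗC) , ≅ₗρ⇒≅ C ρB≅ₗC
    where
    ≅ₗρ⇒≅ : ∀ C → words (ρ B) ≅ₗ words C → C ≅ B
    ≅ₗρ⇒≅ C (κ , _ , κρB≐C) =
      let τ , τρB≐B = ρ-≅ B
      in  flip κ ∘ₚ τ , Image-∘ {σ = flip κ} {τ} (Image-flip {σ = κ} κρB≐C) τρB≐B

theorem9 : ∀ (s : ℕ) .{{_ : NonZero s}}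
    (reps : CanonicalRepresentatives)
    (φ : CanonicalPermutations reps)
    (choices : ChildChoices)
    {ℓ : Level} (U : Pred (Ω s) ℓ) →
    ConsistsOfAllInequivalent U →
    ConsistsOfAllInequivalent (Algorithm.Output reps φ choices U (suc s))
theorem9 s reps φ choices U U-all = record
  { atLeastOne = λ B → case outputs-cover reps φ choices U U-all B of λ (C , C∈ , C≅B) →
                   C , acceptedChild⇒output reps φ choices U C∈ , C≅B
  ; atMostOne  = λ {A} {B} A∈ B∈ → outputs-≐ reps φ choices U U-all {A} {B}
                   (output⇒acceptedChild reps φ choices U A∈)
                   (output⇒acceptedChild reps φ choices U B∈)
  }
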